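{- Let $p\ge2$ be a prime. Then $\mathrm{L}^{\mathrm{Mod}_p\mathrm{L}}=\mathrm{Mod}_p\mathrm{L}$.
   Context: An NL-Turing machine is an $O(\log n)$-space bounded nondeterministic Turing machine (read-only input tape, space counted on the work tape, halting on all paths). $\sharp\mathrm{L}$ is the class of functions $f:\Sigma^*\to\{0,1,2,\dots\}$ for which there is an NL-Turing machine $M$ with $f(x)$ equal to the number of accepting computation paths of $M$ on $x$. $\mathrm{Mod}_p\mathrm{L}$ is the class of languages $L\subseteq\Sigma^*$ for which there is $f\in\sharp\mathrm{L}$ such that for all $x$: $x\in L$ if and only if $f(x)\not\equiv0\pmod p$. For a class $\mathcal{C}$ of languages, $\mathrm{L}^{\mathcal{C}}$ is the class of languages accepted by an $O(\log n)$-space bounded deterministic oracle Turing machine with oracle access to some language $A\in\mathcal{C}$. An oracle machine has a separate write-only oracle tape (not counted in the space bound; queries have polynomial length); when it enters the query state with $y$ on the oracle tape, in the next step the tape is erased and the machine enters $q_{YES}$ or $q_{NO}$ according to whether $y\in A$. -}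

module Defs where

open import Level using (0ℓ) renaming (suc to lsuc)
open import Data.Bool using (Bool; T)
open import Data.Fin using (Fin)
open import Data.List using (List; []; _∷_; _++_; length; fromMaybe)
open import Data.Maybe using (Maybe; just; nothing)
open import Data.Nat using (ℕ; zero; suc; pred; _+_; _*_; _^_; _≤_; _⊓_)
open import Data.Nat.Divisibility using (_∤_)
open import Data.Nat.Logarithm using (⌊log₂_⌋)
open import Data.Product using (∃; ∃-syntax; _×_; _,_; proj₁; proj₂)
open import Function using (flip)
open import Function.Bundles using (_↔_; _⇔_)
open import Induction.WellFounded using (Acc)
open import Relation.Binary.Construct.Closure.ReflexiveTransitive using (Star)
open import Relation.Binary.PropositionalEquality using (_≡_; _≢_)
open import Relation.Nullary using (¬_)
open import Relation.Unary using (Pred; _∈_; _∉_)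

Finite : Set → Set
Finite A = ∃[ n ] (A ↔ Fin n)

Language : Set → Set₁
Language Σ = Pred (List Σ) 0ℓ

data Dir : Set where
  left stay right : Dir

-- The input w is presented as ⊢ w ⊣.
data InputSymbol (Σ : Set) : Set where
  ⊢ ⊣  : InputSymbol Σ
  char : Σ → InputSymbol Σ

-- Head position 0 is ⊢ and position 1 + length w is ⊣.
scan : {Σ : Set} → List Σ → ℕ → InputSymbol Σ
scan w zero = ⊢
scan w (suc i) = go w i
  where
  go : {Σ : Set} → List Σ → ℕ → InputSymbol Σ
  go []      _       = ⊣
  go (a ∷ _) zero    = char a
  go (_ ∷ v) (suc j) = go v j

-- The input head cannot leave ⊢ w ⊣: a move past an endmarker leaves it in
-- place.
moveInput : {Σ : Set} → List Σ → Dir → ℕ → ℕ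
moveInput w left  i = pred i
moveInput w stay  i = i
moveInput w right i = suc i ⊓ suc (length w)

-- A work tape, infinite in both directions.  Only the cells visited so far are
-- stored, those nearest to the head first; every other cell is blank.
record Tape (Γ : Set) : Set where
  constructor tape
  field
    before  : List Γ
    current : Γ
    after   : List Γ

visited : {Γ : Set} → Tape Γ → ℕ
visited (tape l _ r) = suc (length l + length r)

writeMove : {Γ : Set} → (blank : Γ) → Γ → Dir → Tape Γ → Tape Γ
writeMove b g left  (tape []      _ r)       = tape [] b (g ∷ r)
writeMove b g left  (tape (h ∷ l) _ r)       = tape l h (g ∷ r)
writeMove b g stay  (tape l       _ r)       = tape l g r
writeMove b g right (tape l       _ [])      = tape (g ∷ l) b []
writeMove b g right (tape l       _ (h ∷ r)) = tape (g ∷ l) h r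

record Action (Q Γ : Set) : Set where
  constructor action
  field
    next     : Q
    write    : Γ
    inputDir : Dir
    workDir  : Dir

record Config (Q Γ : Set) : Set where
  constructor config
  field
    state : Q
    head  : ℕ
    work  : Tape Γ

open Config public

initial : {Q Γ : Set} → Q → Γ → Config Q Γ
initial q b = config q 0 (tape [] b [])

space : {Q Γ : Set} → Config Q Γ → ℕ
space c = visited (work c)

perform : {Σ Q Γ : Set} → (blank : Γ) → List Σ →
          Action Q Γ → Config Q Γ → Config Q Γ
perform b w (action q g d e) (config _ i t) =
  config q (moveInput w d i) (writeMove b g e t)

-- s ∈ O(log n).  The successor matters only for n ≤ 1, where ⌊log₂ n ⌋ = 0 but
-- at least one cell is always in use.
LogBound : (constant n s : ℕ) → Set
LogBound C n s = s ≤ C * suc ⌊log₂ n ⌋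

------------------------------------------------------------------------
-- Nondeterministic machines and counting

record NTM (Σ : Set) : Set₁ where
  field
    Q Γ      : Set
    finiteQ  : Finite Q
    finiteΓ  : Finite Γ
    start    : Q
    blank    : Γ
    accept   : Q → Bool
    δ        : Q → InputSymbol Σ → Γ → Action Q Γ → Bool
    -- Accepting states are halting.
    accept-δ : ∀ {q s g a} → T (accept q) → ¬ T (δ q s g a)

module _ {Σ : Set} (M : NTM Σ) (w : List Σ) where
  open NTM M

  Enabled : Config Q Γ → Action Q Γ → Set
  Enabled c a = T (δ (state c) (scan w (head c)) (Tape.current (work c)) a)

  data _⟶_ (c : Config Q Γ) : Config Q Γ → Set where
    move : ∀ {a} → Enabled c a → c ⟶ perform blank w a c

  -- A computation path is the sequence of transitions taken.
  data AcceptingPath (c : Config Q Γ) : Set where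
    done : T (accept (state c)) → AcceptingPath c
    step : ∀ a → Enabled c a → AcceptingPath (perform blank w a c) →
           AcceptingPath c

  AcceptingPaths : Set
  AcceptingPaths = AcceptingPath (initial start blank)

  -- Every computation path from the initial configuration is finite.
  Halts : Set
  Halts = Acc (flip _⟶_) (initial start blank)

module _ {Σ : Set} (M : NTM Σ) where
  open NTM M

  LogSpace : Set
  LogSpace = ∃[ C ] ∀ w {c} → Star (_⟶_ M w) (initial start blank) c →
             LogBound C (length w) (space c)

  IsNL : Set
  IsNL = LogSpace × (∀ w → Halts M w)

♯L : {Σ : Set} → Pred (List Σ → ℕ) (lsuc 0ℓ)
♯L {Σ} f = ∃[ M ] IsNL {Σ} M × (∀ w → Fin (f w) ↔ AcceptingPaths M w)

Mod_L : {Σ : Set} → ℕ → Pred (Language Σ) (lsuc 0ℓ)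
Mod_L p L = ∃[ f ] f ∈ ♯L × (∀ w → w ∈ L ⇔ p ∤ f w)

------------------------------------------------------------------------
-- Deterministic oracle machines

record OracleTM (Σ : Set) : Set₁ where
  field
    Q Γ          : Set
    finiteQ      : Finite Q
    finiteΓ      : Finite Γ
    start        : Q
    query        : Q
    yes no       : Q
    blank        : Γ
    accept       : Q → Bool
    -- The second component is the symbol, if any, appended to the oracle tape.
    -- The value at query is never used.
    δ            : Q → InputSymbol Σ → Γ → Maybe (Action Q Γ × Maybe Σ)
    accept-δ     : ∀ {q s g} → T (accept q) → δ q s g ≡ nothing
    accept-query : ¬ T (accept query)

module _ {Σ : Set} (M : OracleTM Σ) (A : Language Σ) (w : List Σ) where
  open OracleTM M

  -- The second component is the content of the oracle tape.
  OracleConfig : Set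
  OracleConfig = Config Q Γ × List Σ

  initialO : OracleConfig
  initialO = initial start blank , []

  data _⟶ᴼ_ : OracleConfig → OracleConfig → Set where
    move : ∀ {c y a o} → state c ≢ query →
           δ (state c) (scan w (head c)) (Tape.current (work c)) ≡ just (a , o) →
           (c , y) ⟶ᴼ (perform blank w a c , y ++ fromMaybe o)
    ask-yes : ∀ {i t y} → y ∈ A →
              (config query i t , y) ⟶ᴼ (config yes i t , [])
    ask-no  : ∀ {i t y} → y ∉ A →
              (config query i t , y) ⟶ᴼ (config no i t , [])

  Reachable : OracleConfig → Set
  Reachable = Star _⟶ᴼ_ initialO

  Accepts : Set
  Accepts = ∃[ c ] Reachable c × T (accept (state (proj₁ c)))

module _ {Σ : Set} (M : OracleTM Σ) (A : Language Σ) where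
  open OracleTM M

  LogSpaceᴼ : Set
  LogSpaceᴼ = ∃[ C ] ∀ w {c} → Reachable M A w c →
              LogBound C (length w) (space (proj₁ c))

  -- Every polynomial is bounded by n ^ k + k for some k.
  PolyQueries : Set
  PolyQueries = ∃[ k ] ∀ w {c y} → Reachable M A w (c , y) →
                state c ≡ query → length y ≤ length w ^ k + k

L^_ : {Σ : Set} → Pred (Language Σ) (lsuc 0ℓ) → Pred (Language Σ) (lsuc 0ℓ)
(L^_ {Σ} 𝒞) L = ∃[ A ] A ∈ 𝒞 ×
  ∃[ M ] LogSpaceᴼ {Σ} M A × PolyQueries M A × (∀ w → w ∈ L ⇔ Accepts M A w)

{-# OPTIONS --safe #-}
-- Let M be a log-space oracle machine and f ∈ ♯L count the accepting paths of a
-- machine N deciding the oracle modulo p.  A nondeterministic machine simulates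
-- M and guesses the answer to every query y, giving the guess a weight: for yes
-- it runs N on y, with f(y) accepting paths; for no it runs p − 1 times in a row
-- either N on y or one of c free choices, for c = p − 1, …, 1, which gives
-- (f(y) + 1) ⋯ (f(y) + p − 1) accepting paths.  As p is prime, the weight of a
-- wrong guess is divisible by p and that of a right guess is not, so modulo p
-- only the path of right guesses counts.  The query itself is never stored: the
-- configuration of M after its latest query is kept, and M is rerun from there
-- whenever N reads a symbol.  What the simulation does after a wrong guess is
-- irrelevant as long as it halts in logarithmic space, so it is cut off when it
-- leaves the cells marked off at the start or when one of two clocks runs out:
-- by the pigeonhole principle neither the number of steps between two queries
-- nor the number of queries of an accepting run exceeds the number of
-- configurations.
--
-- All stacks, counters and clocks are tracks of one list of cells, and each
-- elementary operation is a transducer passing over that list.  Conversely, a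
-- machine that copies its input to the oracle tape reduces a language to itself.
module Submission where

open import Defs
open import Data.Bool using (Bool; true; false; T; if_then_else_)
open import Data.Bool.Properties using (T-irrelevant; T?)
open import Data.Empty using (⊥; ⊥-elim)
open import Data.Fin as Fin using (Fin; zero; suc; toℕ; fromℕ<)
open import Data.Fin.Patterns using (0F; 1F; 2F; 3F; 4F; 5F; 6F; 7F; 8F; 9F)
open import Data.Fin.Permutation using (↔⇒≡)
import Data.Fin.Properties as Fin
open import Data.List as List using (List; []; _∷_; _++_; _ʳ++_; length; fromMaybe)
open import Data.List.Membership.Propositional using (_∈_)
open import Data.List.Membership.DecPropositional as DecMembership using ()
open import Data.List.Membership.Propositional.Properties using (Any↔; ∈-map⁺; ∈-allFin; ∈-filter⁺; ∈-filter⁻)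
open import Data.List.Membership.Propositional.Properties.WithK using (unique⇒irrelevant)
import Data.List.Properties as List
open import Data.List.Relation.Unary.All as All using (All; []; _∷_)
import Data.List.Relation.Unary.All.Properties as All
open import Data.List.Relation.Unary.Any using (Any; here; there)
import Data.List.Relation.Unary.Any.Properties as Any
open import Data.List.Relation.Unary.Unique.Propositional using (Unique; []; _∷_)
import Data.List.Relation.Unary.Unique.Propositional.Properties as Unique
open import Data.Maybe as Maybe using (Maybe; just; nothing)
open import Data.Nat using (ℕ; zero; suc; _+_; _*_; _∸_; _^_; _≤_; _<_; z≤n; s≤s; _≤?_)
open import Data.Nat.DivMod using (_/_; _%_; m≡m%n+[m/n]*n; m%n<n)
open import Data.Nat.Divisibility using (_∣_; _∤_; _∣?_; divides; ∣m⇒∣m*n; ∣n⇒∣m*n; ∣m∣n⇒∣m+n; ∣m+n∣m⇒∣n; >⇒∤; m%n≡0⇒n∣m; ∣-trans)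
open import Data.Nat.Logarithm using (⌊log₂_⌋; ⌊log₂⌋-mono-≤; ⌊log₂[2^n]⌋≡n)
open import Data.Nat.Primality using (Prime; euclidsLemma; ¬prime[0]; ¬prime[1])
import Data.Nat.Properties as ℕ
open import Data.Nat.Tactic.RingSolver using (solve-∀)
open import Data.Product using (Σ; ∃; ∃-syntax; _×_; _,_; proj₁; proj₂)
open import Data.Product.Function.NonDependent.Propositional using (_×-↔_)
open import Data.Sum using (_⊎_; inj₁; inj₂; [_,_]′)
open import Data.Sum.Function.Propositional using (_⊎-↔_)
open import Data.Unit using (⊤; tt)
open import Data.Vec as Vec using (Vec; []; _∷_; _[_]≔_; lookup; replicate; tabulate)
import Data.Vec.Properties as Vec
open import Function using (flip; _∘_; id)
open import Function.Bundles using (_↔_; _⇔_; mk⇔; mk↔ₛ′; Inverse; Equivalence)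
open import Function.Properties.Inverse using (↔-refl; ↔-sym; ↔-trans; ↔⇒↣)
open import Induction.WellFounded using (Acc; acc)
open import Relation.Binary using (DecidableEquality)
open import Relation.Binary.Construct.Closure.ReflexiveTransitive using (Star; ε; _◅_; _◅◅_)
open import Relation.Binary.PropositionalEquality using (_≡_; _≢_; refl; sym; trans; cong; cong₂; subst; module ≡-Reasoning)
open import Relation.Nullary using (¬_; Dec; yes; no; contradiction)
open import Relation.Nullary.Decidable using (⌊_⌋; toWitness; fromWitness; via-injection; decidable-stable; _×-dec_)
open import Relation.Unary using (Pred; _≐_) renaming (_∈_ to _∈ᴸ_; _∉_ to _∉ᴸ_)

-- Finite types

-- The obstacle is that the bounds on `M` hold only along its true computation: space and query
-- length are controlled for reachable configurations, whereas a ♯L machine must halt within its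
-- space on every path, also after a wrong guess, when `N` may be run on a word that is too long.
-- Hence the exact path count `total` is defined for versions of `M` and `N` that are pruned to the
-- cells at hand, without mention of an oracle, and the truth of the guesses enters only in the
-- comparison modulo p, `total-correct`. The weights need not be 0 or 1 modulo p: membership asks
-- only whether the count is nonzero, so a factor prime to p on the right path does no harm. The
-- product for a no fits because f(y), ..., f(y) + p - 1 are p consecutive numbers, exactly one of
-- which is divisible by p. The clock on queries is justified because a query erases the oracle
-- tape: the configuration after it determines the rest of the run.

finite-↔ : {A B : Set} → A ↔ B → Finite B → Finite A
finite-↔ e (n , f) = n , ↔-trans e f

finite-Fin : ∀ n → Finite (Fin n)
finite-Fin n = n , ↔-refl

finite-⊤ : Finite ⊤
finite-⊤ = 1 , ↔-sym Fin.1↔⊤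

finite-Bool : Finite Bool
finite-Bool = 2 , ↔-sym Fin.2↔Bool

finite-⊎ : {A B : Set} → Finite A → Finite B → Finite (A ⊎ B)
finite-⊎ (m , f) (n , g) = m + n , ↔-trans (f ⊎-↔ g) (↔-sym Fin.+↔⊎)

finite-× : {A B : Set} → Finite A → Finite B → Finite (A × B)
finite-× (m , f) (n , g) = m * n , ↔-trans (f ×-↔ g) (↔-sym Fin.*↔×)

finite-Maybe : {A : Set} → Finite A → Finite (Maybe A)
finite-Maybe {A} f = finite-↔ e (finite-⊎ finite-⊤ f)
  where
  e : Maybe A ↔ (⊤ ⊎ A)
  e = mk↔ₛ′ (Maybe.maybe′ inj₂ (inj₁ tt)) [ (λ _ → nothing) , just ]′
    (λ { (inj₁ _) → refl ; (inj₂ _) → refl }) (λ { nothing → refl ; (just _) → refl })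

finite-Vec : {A : Set} → Finite A → ∀ n → Finite (Vec A n)
finite-Vec f zero    = finite-↔ (mk↔ₛ′ (λ _ → tt) (λ _ → []) (λ _ → refl) (λ { [] → refl })) finite-⊤
finite-Vec f (suc n) = finite-↔ e (finite-× f (finite-Vec f n))
  where
  e : Vec _ (suc n) ↔ (_ × Vec _ n)
  e = mk↔ₛ′ (λ v → Vec.head v , Vec.tail v) (λ (x , v) → x ∷ v) (λ _ → refl) (λ { (_ ∷ _) → refl })

finite-Dir : Finite Dir
finite-Dir = 3 , mk↔ₛ′ (λ { left → 0F ; stay → 1F ; right → 2F }) (λ { 0F → left ; 1F → stay ; 2F → right })
  (λ { 0F → refl ; 1F → refl ; 2F → refl }) (λ { left → refl ; stay → refl ; right → refl })

finite-InputSymbol : {A : Set} → Finite A → Finite (InputSymbol A)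
finite-InputSymbol {A} f = finite-↔ e (finite-⊎ finite-Bool f)
  where
  e : InputSymbol A ↔ (Bool ⊎ A)
  e = mk↔ₛ′ (λ { ⊢ → inj₁ true ; ⊣ → inj₁ false ; (char a) → inj₂ a })
    (λ { (inj₁ true) → ⊢ ; (inj₁ false) → ⊣ ; (inj₂ a) → char a })
    (λ { (inj₁ true) → refl ; (inj₁ false) → refl ; (inj₂ a) → refl })
    (λ { ⊢ → refl ; ⊣ → refl ; (char a) → refl })

finite-Action : {Q Γ : Set} → Finite Q → Finite Γ → Finite (Action Q Γ)
finite-Action f g = finite-↔ e (finite-× f (finite-× g (finite-× finite-Dir finite-Dir)))
  where
  e : Action _ _ ↔ (_ × _ × Dir × Dir)
  e = mk↔ₛ′ (λ (action q g d e) → q , g , d , e) (λ (q , g , d , e) → action q g d e)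
        (λ _ → refl) (λ _ → refl)

finite-Σ : ∀ n {F : Fin n → Set} → (∀ i → Finite (F i)) → Finite (Σ (Fin n) F)
finite-Σ zero        f = finite-↔ (mk↔ₛ′ proj₁ (λ ()) (λ ()) (λ ())) (finite-Fin 0)
finite-Σ (suc n) {F} f = finite-↔ e (finite-⊎ (f zero) (finite-Σ n (f ∘ suc)))
  where
  e : Σ (Fin (suc n)) F ↔ (F zero ⊎ Σ (Fin n) (F ∘ suc))
  e = mk↔ₛ′ (λ { (zero , x) → inj₁ x ; (suc i , x) → inj₂ (i , x) })
    [ (λ x → zero , x) , (λ (i , x) → suc i , x) ]′
    (λ { (inj₁ _) → refl ; (inj₂ _) → refl }) (λ { (zero , _) → refl ; (suc _ , _) → refl })

decEq : {A : Set} → Finite A → DecidableEquality A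
decEq (n , e) = via-injection (↔⇒↣ e) Fin._≟_

module Enumeration {A : Set} (finite : Finite A) where
  private
    e = proj₂ finite

  elements : List A
  elements = List.map (Inverse.from e) (List.allFin (proj₁ finite))

  elements-complete : ∀ a → a ∈ elements
  elements-complete a =
    subst (_∈ elements) (Inverse.strictlyInverseʳ e a) (∈-map⁺ (Inverse.from e) (∈-allFin (Inverse.to e a)))

  elements-unique : Unique elements
  elements-unique = Unique.map⁺ inj (Unique.allFin⁺ _)
    where
    inj : ∀ {i j} → Inverse.from e i ≡ Inverse.from e j → i ≡ j
    inj {i} {j} eq = trans (sym (Inverse.strictlyInverseˡ e i)) (trans (cong (Inverse.to e) eq) (Inverse.strictlyInverseˡ e j))

module _ {Σ : Set} (N : NTM Σ) where
  open NTM N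

  enabledActions : Q → InputSymbol Σ → Γ → List (Action Q Γ)
  enabledActions q s g = List.filter (λ a → T? (δ q s g a)) (Enumeration.elements (finite-Action finiteQ finiteΓ))

  enabledActions-unique : ∀ q s g → Unique (enabledActions q s g)
  enabledActions-unique q s g =
    Unique.filter⁺ (λ a → T? (δ q s g a)) (Enumeration.elements-unique (finite-Action finiteQ finiteΓ))

  enabledActions-complete : ∀ {q s g a} → T (δ q s g a) → a ∈ enabledActions q s g
  enabledActions-complete {q} {s} {g} {a} =
    ∈-filter⁺ (λ a → T? (δ q s g a)) (Enumeration.elements-complete (finite-Action finiteQ finiteΓ) a)

  enabledActions-sound : ∀ q s g → All (λ a → T (δ q s g a)) (enabledActions q s g)
  enabledActions-sound q s g = All.tabulate λ i → proj₂ (∈-filter⁻ (λ a → T? (δ q s g a)) {xs = Enumeration.elements (finite-Action finiteQ finiteΓ)} i)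

-- Counting accepting paths

-- Comp P c n is a proof that every path from c is finite and stays in P, and
-- that n of them are accepting.  It is built along the tree of computations.
module Counting {Σ : Set} (M : NTM Σ) (w : List Σ) (P : Config (NTM.Q M) (NTM.Γ M) → Set) where
  open NTM M

  mutual
    data Comp (c : Config Q Γ) : ℕ → Set where
      accepting : P c → T (accept (state c)) → Comp c 1
      branching : ∀ {as n} → P c → ¬ T (accept (state c)) →
                  Unique as → (∀ {a} → Enabled M w c a → a ∈ as) → All (Enabled M w c) as →
                  Branches c as n → Comp c n

    data Branches (c : Config Q Γ) : List (Action Q Γ) → ℕ → Set where
      []  : Branches c [] 0
      _∷_ : ∀ {a as m n} → Comp (perform blank w a c) m → Branches c as n → Branches c (a ∷ as) (m + n)

  comp-P : ∀ {c n} → Comp c n → P c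
  comp-P (accepting p _)         = p
  comp-P (branching p _ _ _ _ _) = p

  mutual
    next : ∀ {c c′ n} → Comp c n → _⟶_ M w c c′ → ∃ (Comp c′)
    next (accepting _ a)            (move e) = contradiction e (accept-δ a)
    next (branching _ _ _ in-as _ bs) (move e) = branch bs (in-as e)

    branch : ∀ {c as n a} → Branches c as n → a ∈ as → ∃ (Comp (perform blank w a c))
    branch (t ∷ _)  (here refl) = _ , t
    branch (_ ∷ bs) (there i)   = branch bs i

  reachable-P : ∀ {c c′ n} → Comp c n → Star (_⟶_ M w) c c′ → P c′
  reachable-P t ε        = comp-P t
  reachable-P t (s ◅ ss) = reachable-P (proj₂ (next t s)) ss

  mutual
    halting : ∀ {c n} → Comp c n → Acc (flip (_⟶_ M w)) c
    halting (accepting _ a)             = acc λ { (move e) → contradiction e (accept-δ a) }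
    halting (branching _ _ _ in-as _ bs) = acc λ { (move e) → halting-branch bs (in-as e) }

    halting-branch : ∀ {c as n a} → Branches c as n → a ∈ as → Acc (flip (_⟶_ M w)) (perform blank w a c)
    halting-branch (t ∷ _)  (here refl) = halting t
    halting-branch (_ ∷ bs) (there i)   = halting-branch bs i

  private
    After : Config Q Γ → Action Q Γ → Set
    After c a = AcceptingPath M w (perform blank w a c)

    accepted : ∀ {c} → T (accept (state c)) → Fin 1 ↔ AcceptingPath M w c
    accepted a = ↔-trans Fin.1↔⊤ (mk↔ₛ′ (λ _ → done a) (λ _ → tt)
      (λ { (done b) → cong done (T-irrelevant a b) ; (step _ e _) → contradiction e (accept-δ a) }) (λ _ → refl))

    -- Since the list has no duplicates, its membership proofs are unique, so each enabled action
    -- occupies exactly one position and no path is counted twice.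
    first-step : ∀ {c as} → ¬ T (accept (state c)) → Unique as →
                 (∀ {a} → Enabled M w c a → a ∈ as) → All (Enabled M w c) as →
                 Any (After c) as ↔ AcceptingPath M w c
    first-step {c} {as} ¬acc uniq in-as ens = ↔-trans (↔-sym Any↔) (mk↔ₛ′
      (λ (a , i , π) → step a (All.lookup ens i) π)
      (λ { (done b) → contradiction b ¬acc ; (step a e π) → a , in-as e , π })
      (λ { (done b) → contradiction b ¬acc ; (step a e π) → cong (λ e → step a e π) (T-irrelevant _ _) })
      (λ (a , i , π) → cong (λ i → a , i , π) (unique⇒irrelevant uniq _ _)))

  mutual
    paths : ∀ {c n} → Comp c n → Fin n ↔ AcceptingPath M w c
    paths (accepting _ a)                      = accepted a
    paths (branching _ ¬acc uniq in-as ens bs) =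
      ↔-trans (branch-paths bs) (first-step ¬acc uniq in-as ens)

    branch-paths : ∀ {c as n} → Branches c as n → Fin n ↔ Any (After c) as
    branch-paths         []       = mk↔ₛ′ (λ ()) (λ ()) (λ ()) (λ ())
    branch-paths {c = c} (t ∷ bs) = ↔-trans Fin.+↔⊎ (↔-trans (paths t ⊎-↔ branch-paths bs) (Any.∷↔ (After c)))

-- Machines that sweep over a list of cells

data Instr (V C R : Set) : Set where
  goto  : Dir → List V → Instr V C R
  sweep : (r₀ : R) (out : R → C → R × C) (turn : R → Maybe C × R) (back : R → C → R × C)
          (cont : R → V) → Instr V C R

-- A sweeper keeps a list of cells.  Its instructions either branch, moving the
-- input head, or pass over the whole list and back with a transducer each way;
-- at the turn one new cell may be appended.
record Sweeper (Σ : Set) : Set₁ where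
  field
    V C R   : Set
    finiteV : Finite V
    finiteC : Finite C
    finiteR : Finite R
    start   : V
    final   : V → Bool
    instr   : V → InputSymbol Σ → Instr V C R

-- The pass as the head performs it on a two-sided tape: finished cells pile up in reverse order on
-- the far side. `passʳ` and `passˡ` give the two directions in list order, which is what the
-- correctness proofs use.
pass : {C R : Set} → (R → C → R × C) → R → List C → List C → R × List C
pass f r []      ys = r , ys
pass f r (c ∷ u) ys = pass f (proj₁ (f r c)) u (proj₂ (f r c) ∷ ys)

passʳ passˡ : {C R : Set} → (R → C → R × C) → R → List C → R × List C
passʳ f r []      = r , []
passʳ f r (c ∷ u) = let r′ , c′ = f r c ; r″ , u′ = passʳ f r′ u in r″ , c′ ∷ u′
passˡ f r []      = r , []
passˡ f r (c ∷ u) = let r′ , u′ = passˡ f r u ; r″ , c′ = f r′ c in r″ , c′ ∷ u′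

pass≡passʳ : {C R : Set} (f : R → C → R × C) (r : R) (u ys : List C) →
             pass f r u ys ≡ (proj₁ (passʳ f r u) , proj₂ (passʳ f r u) ʳ++ ys)
pass≡passʳ f r []      ys = refl
pass≡passʳ f r (c ∷ u) ys = pass≡passʳ f (proj₁ (f r c)) u (proj₂ (f r c) ∷ ys)

pass-ʳ++ : {C R : Set} (f : R → C → R × C) (r : R) (u xs ys : List C) →
           pass f r (u ʳ++ xs) ys ≡ pass f (proj₁ (passˡ f r u)) xs (proj₂ (passˡ f r u) ++ ys)
pass-ʳ++ f r []      xs ys = refl
pass-ʳ++ f r (c ∷ u) xs ys = pass-ʳ++ f r u (c ∷ xs) ys

length-passʳ : {C R : Set} (f : R → C → R × C) (r : R) (u : List C) → length (proj₂ (passʳ f r u)) ≡ length u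
length-passʳ f r []      = refl
length-passʳ f r (c ∷ u) = cong suc (length-passʳ f _ u)

module Sweeping {Σ : Set} (S : Sweeper Σ) where
  open Sweeper S

  Q′ Γ′ : Set
  Q′ = V ⊎ (V × Bool × R)
  Γ′ = Maybe C

  finiteQ′ : Finite Q′
  finiteQ′ = finite-⊎ finiteV (finite-× finiteV (finite-× finite-Bool finiteR))

  pattern out v r  = inj₂ (v , true , r)
  pattern back v r = inj₂ (v , false , r)

  begin : V → Instr V C R → List (Action Q′ Γ′)
  begin v (goto d vs)         = List.map (λ v′ → action (inj₁ v′) nothing d stay) vs
  begin v (sweep r₀ _ _ _ _) = action (out v r₀) nothing stay right ∷ []

  during : V → Bool → R → Γ′ → Instr V C R → List (Action Q′ Γ′)
  during v _     r _        (goto _ _)          = []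
  during v true  r (just c) (sweep _ f _ _ _)   = action (out v (proj₁ (f r c))) (just (proj₂ (f r c))) stay right ∷ []
  during v true  r nothing  (sweep _ _ t _ _)   = action (back v (proj₂ (t r))) (proj₁ (t r)) stay left ∷ []
  during v false r (just c) (sweep _ _ _ f _)   = action (back v (proj₁ (f r c))) (just (proj₂ (f r c))) stay left ∷ []
  during v false r nothing  (sweep _ _ _ _ k)   = action (inj₁ (k r)) nothing stay stay ∷ []

  steps : Q′ → InputSymbol Σ → Γ′ → List (Action Q′ Γ′)
  steps (inj₁ v)           s g = if final v then [] else begin v (instr v s)
  steps (inj₂ (v , b , r)) s g = during v b r g (instr v s)

  open DecMembership (decEq (finite-Action finiteQ′ (finite-Maybe finiteC))) using (_∈?_)

  accepts : Q′ → Bool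
  accepts (inj₁ v) = final v
  accepts (inj₂ _) = false

  machine : NTM Σ
  machine = record
    { Q = Q′ ; Γ = Γ′
    ; finiteQ = finiteQ′ ; finiteΓ = finite-Maybe finiteC
    ; start = inj₁ start ; blank = nothing
    ; accept = accepts
    ; δ = λ q s g a → ⌊ a ∈? steps q s g ⌋
    ; accept-δ = λ {q} {s} {g} {a} → halted q s g a
    }
    where
    halted : ∀ q s g a → T (accepts q) → ¬ T ⌊ a ∈? steps q s g ⌋
    halted (inj₁ v) s g a t with final v
    ... | true = λ ()

  pad : Bool → List Γ′
  pad e = if e then nothing ∷ [] else []

  -- At rest the head is on the blank cell to the left of the list.
  parked : List C → Bool → Tape Γ′
  parked u e = tape [] nothing (List.map just u ++ pad e)

  module Run (w : List Σ) (B : ℕ) where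
    open Counting machine w (λ c → space c ≤ B) public

    -- Whether the blank cell to the right of the list has been visited does not matter.
    At : V → ℕ → List C → ℕ → Set
    At v i u n = ∀ e → Comp (config (inj₁ v) i (parked u e)) n

    data Alternatives (i : ℕ) (u : List C) : List V → ℕ → Set where
      []  : Alternatives i u [] 0
      _∷_ : ∀ {v vs m n} → At v i u m → Alternatives i u vs n → Alternatives i u (v ∷ vs) (m + n)

    private
      length-pad : ∀ e → length (pad e) ≤ 1
      length-pad true  = s≤s z≤n
      length-pad false = z≤n

      length-tape : ∀ {u : List C} {e} → length (List.map just u ++ pad e) ≤ suc (length u)
      length-tape {u} {e} = ℕ.≤-trans
        (ℕ.≤-reflexive (trans (List.length-++ (List.map just u)) (cong (_+ length (pad e)) (List.length-map just u))))
        (ℕ.≤-trans (ℕ.+-monoʳ-≤ (length u) (length-pad e)) (ℕ.≤-reflexive (ℕ.+-comm (length u) 1)))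

      enabled : ∀ {q i t a} → a ∈ steps q (scan w i) (Tape.current t) → Enabled machine w (config q i t) a
      enabled = fromWitness

      one : ∀ {q i t a n} → ¬ T (accepts q) → visited t ≤ B →
            steps q (scan w i) (Tape.current t) ≡ a ∷ [] →
            Comp (config (Action.next a) (moveInput w (Action.inputDir a) i) (writeMove nothing (Action.write a) (Action.workDir a) t)) n →
            Comp (config q i t) n
      one {q} {i} {t} {a} {n} ¬acc b eq k = subst (Comp _) (ℕ.+-identityʳ n)
        (branching b ¬acc ([] ∷ []) (λ e → subst (_ ∈_) eq (toWitness e))
          (enabled {q} {i} {t} (subst (a ∈_) (sym eq) (here refl)) ∷ []) (k ∷ []))

      rightOf leftOf : List Γ′ → List Γ′ → Tape Γ′
      rightOf l []      = tape l nothing []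
      rightOf l (x ∷ r) = tape l x r
      leftOf []      r = tape [] nothing r
      leftOf (x ∷ l) r = tape l x r

      move-right : ∀ g l x r → writeMove nothing g right (tape l x r) ≡ rightOf (g ∷ l) r
      move-right g l x []      = refl
      move-right g l x (_ ∷ _) = refl

      move-left : ∀ g l x r → writeMove nothing g left (tape l x r) ≡ leftOf l (g ∷ r)
      move-left g []      x r = refl
      move-left g (_ ∷ _) x r = refl

      done-part : List C → List Γ′
      done-part us = List.map just us ++ nothing ∷ []

      length-done : ∀ us → length (done-part us) ≡ suc (length us)
      length-done []       = refl
      length-done (_ ∷ us) = cong suc (length-done us)

      out-space : ∀ us u e → visited (rightOf (done-part us) (List.map just u ++ pad e)) ≤ 2 + (length us + length u)
      out-space us []      true  = s≤s (ℕ.≤-reflexive (cong (_+ 0) (length-done us)))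
      out-space us []      false = s≤s (ℕ.≤-reflexive (cong (_+ 0) (length-done us)))
      out-space us (c ∷ u) e     = s≤s (ℕ.≤-trans (ℕ.+-mono-≤ (ℕ.≤-reflexive (length-done us)) (length-tape {u}))  (ℕ.≤-refl))

      back-space : ∀ us u e → visited (leftOf (done-part us) (List.map just u ++ pad e)) ≤ 2 + (length us + length u)
      back-space []       u e = s≤s (length-tape {u})
      back-space (x ∷ us) u e = s≤s (ℕ.≤-trans (ℕ.+-mono-≤ (ℕ.≤-reflexive (length-done us)) (length-tape {u}))
        (ℕ.≤-reflexive (cong suc (ℕ.+-suc (length us) (length u)))))

    module _ {v : V} {i : ℕ} {r₀ f t g k} (eq : instr v (scan w i) ≡ sweep r₀ f t g k) where
      private
        out-pass : ∀ u r us e {n} → 2 + (length us + length u) ≤ B →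
          Comp (config (out v (proj₁ (pass f r u us))) i (tape (done-part (proj₂ (pass f r u us))) nothing [])) n →
          Comp (config (out v r) i (rightOf (done-part us) (List.map just u ++ pad e))) n
        out-pass []      r us true  b t = t
        out-pass []      r us false b t = t
        out-pass (c ∷ u) r us e     b t = one id (ℕ.≤-trans (out-space us (c ∷ u) e) b) (cong (during v true r (just c)) eq)
          (subst (λ τ → Comp (config _ i τ) _) (sym (move-right _ (done-part us) _ (List.map just u ++ pad e)))
            (out-pass u _ (_ ∷ us) e (ℕ.≤-trans (ℕ.≤-reflexive (cong (2 +_) (sym (ℕ.+-suc (length us) (length u))))) b) t))

        back-pass : ∀ us r u e {n} → 2 + (length us + length u) ≤ B →
          Comp (config (back v (proj₁ (pass g r us u))) i (tape [] nothing (List.map just (proj₂ (pass g r us u)) ++ pad e))) n →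
          Comp (config (back v r) i (leftOf (done-part us) (List.map just u ++ pad e))) n
        back-pass []       r u e b t = t
        back-pass (c ∷ us) r u e b t = one id (ℕ.≤-trans (back-space (c ∷ us) u e) b) (cong (during v false r (just c)) eq)
          (subst (λ τ → Comp (config _ i τ) _) (sym (move-left _ (done-part us) _ (List.map just u ++ pad e)))
            (back-pass us _ (_ ∷ u) e (ℕ.≤-trans (ℕ.≤-reflexive (cong (2 +_) (ℕ.+-suc (length us) (length u)))) b) t))

      -- The bound leaves room for the list, a blank at either end, and one cell that the turn may
      -- append.
      at-sweep : ∀ {u n} → 3 + length u ≤ B → ¬ T (final v) →
        let r₁ , u₁ = passʳ f r₀ u ; m , r₂ = t r₁ ; r₃ , u₂ = passˡ g r₂ u₁ in
        At (k r₃) i (u₂ ++ fromMaybe m) n → At v i u n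
      at-sweep {u} {n} b ¬fin K e = one ¬fin (ℕ.≤-trans (s≤s (length-tape {u})) b₂) eq₀
          (subst (λ τ → Comp (config _ i τ) n) (sym (move-right nothing [] nothing (List.map just u ++ pad e)))
            (out-pass u r₀ [] e b₂ (subst (λ z → Comp (config (out v (proj₁ z)) i (tape (done-part (proj₂ z)) nothing [])) n)
              (sym (pass≡passʳ f r₀ u [])) turned)))
        where
        b₂ = ℕ.≤-trans (ℕ.n≤1+n _) b
        r₁ = proj₁ (passʳ f r₀ u)
        u₁ = proj₂ (passʳ f r₀ u)
        m  = proj₁ (t r₁)
        r₂ = proj₂ (t r₁)
        r₃ = proj₁ (passˡ g r₂ u₁)
        u₂ = proj₂ (passˡ g r₂ u₁)
        eq₀ : steps (inj₁ v) (scan w i) nothing ≡ action (out v r₀) nothing stay right ∷ []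
        eq₀ rewrite eq with final v
        ... | true  = contradiction tt ¬fin
        ... | false = refl
        len : length (u₁ ʳ++ []) ≡ length u
        len = trans (List.length-ʳ++ u₁) (trans (ℕ.+-identityʳ _) (length-passʳ f r₀ u))
        -- An appended cell overwrites the blank on the right, so after the turn a visited blank
        -- remains there only if nothing was appended.
        edge : Maybe C → Bool
        edge = Maybe.maybe′ (λ _ → false) true
        edge-tape : ∀ m → m ∷ [] ≡ List.map just (fromMaybe m) ++ pad (edge m)
        edge-tape nothing  = refl
        edge-tape (just _) = refl
        length-m : ∀ (m : Maybe C) → length (fromMaybe m) ≤ 1
        length-m nothing  = z≤n
        length-m (just _) = s≤s z≤n
        b₃ : ∀ m → 2 + (length (u₁ ʳ++ []) + length (fromMaybe m)) ≤ B
        b₃ m = ℕ.≤-trans (s≤s (s≤s (ℕ.≤-trans (ℕ.+-mono-≤ (ℕ.≤-reflexive len) (length-m m)) (ℕ.≤-reflexive (ℕ.+-comm (length u) 1))))) b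
        back-end : Comp (config (back v r₃) i (parked (u₂ ++ fromMaybe m) (edge m))) n
        back-end = one id (ℕ.≤-trans (s≤s (length-tape {u₂ ++ fromMaybe m})) (ℕ.≤-trans (ℕ.≤-reflexive (cong (2 +_)
            (trans (List.length-++ u₂) (cong (_+ length (fromMaybe m)) (trans (length-passˡ u₁ r₂) (sym (trans (List.length-ʳ++ u₁) (ℕ.+-identityʳ _)))))))) (b₃ m)))
          (cong (during v false r₃ nothing) eq) (K _)
          where
          length-passˡ : ∀ u r → length (proj₂ (passˡ g r u)) ≡ length u
          length-passˡ []      r = refl
          length-passˡ (_ ∷ u) r = cong suc (length-passˡ u r)
        turned : Comp (config (out v r₁) i (tape (done-part (u₁ ʳ++ [])) nothing [])) n
        turned = one id (ℕ.≤-trans (s≤s (ℕ.≤-trans (ℕ.≤-reflexive (ℕ.+-identityʳ _)) (ℕ.≤-reflexive (trans (length-done (u₁ ʳ++ [])) (cong suc len))))) b₂)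
          (cong (during v true r₁ nothing) eq)
          (subst (λ τ → Comp (config (back v r₂) i τ) n)
            (sym (trans (move-left m (done-part (u₁ ʳ++ [])) nothing []) (cong (leftOf _) (edge-tape m))))
            (back-pass (u₁ ʳ++ []) r₂ (fromMaybe m) (edge m) (b₃ m)
              (subst (λ z → Comp (config (back v (proj₁ z)) i (parked (proj₂ z) (edge m))) n)
                (sym (pass-ʳ++ g r₂ u₁ [] (fromMaybe m))) back-end)))

    at-final : ∀ {v i u} → 2 + length u ≤ B → T (final v) → At v i u 1
    at-final {u = u} b fin e = accepting (ℕ.≤-trans (s≤s (length-tape {u})) b) fin

    at-goto : ∀ {v i u d vs n} → 2 + length u ≤ B → ¬ T (final v) → instr v (scan w i) ≡ goto d vs →
              Unique vs → Alternatives (moveInput w d i) u vs n → At v i u n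
    at-goto {v} {i} {u} {d} {vs} b ¬fin eq uniq alts e =
      branching (ℕ.≤-trans (s≤s (length-tape {u})) b) ¬fin (Unique.map⁺ (λ { refl → refl }) uniq)
        (λ en → subst (_ ∈_) eq₀ (toWitness en))
        (All.tabulate (λ {a} a∈ → enabled {inj₁ v} {i} {parked u e} (subst (a ∈_) (sym eq₀) a∈)))
        (branches alts)
      where
      eq₀ : steps (inj₁ v) (scan w i) nothing ≡ List.map (λ v′ → action (inj₁ v′) nothing d stay) vs
      eq₀ rewrite eq with final v
      ... | true  = contradiction tt ¬fin
      ... | false = refl
      branches : ∀ {vs n} → Alternatives (moveInput w d i) u vs n →
                 Branches (config (inj₁ v) i (parked u e)) (List.map (λ v′ → action (inj₁ v′) nothing d stay) vs) n
      branches []       = []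
      branches (t ∷ ts) = t e ∷ branches ts

-- Counters and stacks on parallel tracks

module Tracks (β K : ℕ) where

  A : Set
  A = Fin (2 + β)

  base : ℕ
  base = 2 + β

  Transducer : Set
  Transducer = A → A → A × A

  -- Transposition: the proofs speak of `K` tracks of length `L`, while the machine sweeps over `L`
  -- cells, each with one letter of every track.
  cells : ∀ {L} → Vec (Vec A L) K → List (Vec A K)
  cells {zero}  τ = []
  cells {suc L} τ = Vec.map Vec.head τ ∷ cells (Vec.map Vec.tail τ)

  length-cells : ∀ {L} (τ : Vec (Vec A L) K) → length (cells τ) ≡ L
  length-cells {zero}  τ = refl
  length-cells {suc L} τ = cong suc (length-cells (Vec.map Vec.tail τ))

  onTrack : Fin K → Transducer → A → Vec A K → A × Vec A K
  onTrack k f r c = proj₁ (f r (lookup c k)) , c [ k ]≔ proj₂ (f r (lookup c k))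

  passᵛʳ passᵛˡ : ∀ {L} → Transducer → A → Vec A L → A × Vec A L
  passᵛʳ f r []      = r , []
  passᵛʳ f r (a ∷ v) = let r′ , a′ = f r a ; r″ , v′ = passᵛʳ f r′ v in r″ , a′ ∷ v′
  passᵛˡ f r []      = r , []
  passᵛˡ f r (a ∷ v) = let r′ , v′ = passᵛˡ f r v ; r″ , a′ = f r′ a in r″ , a′ ∷ v′

  passʳ-onTrack : ∀ {L} k f r (τ : Vec (Vec A L) K) → passʳ (onTrack k f) r (cells τ) ≡
    (proj₁ (passᵛʳ f r (lookup τ k)) , cells (τ [ k ]≔ proj₂ (passᵛʳ f r (lookup τ k))))
  passʳ-onTrack {zero}  k f r τ with [] ← lookup τ k = refl
  passʳ-onTrack {suc L} k f r τ
    rewrite Vec.lookup-map k Vec.head τ | passʳ-onTrack k f (proj₁ (f r (Vec.head (lookup τ k)))) (Vec.map Vec.tail τ)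
          | Vec.lookup-map k Vec.tail τ
    with x ∷ xs ← lookup τ k
    = cong₂ _,_ refl (cong₂ _∷_ (sym (Vec.map-[]≔ Vec.head τ k)) (cong cells (sym (Vec.map-[]≔ Vec.tail τ k))))

  passˡ-onTrack : ∀ {L} k f r (τ : Vec (Vec A L) K) → passˡ (onTrack k f) r (cells τ) ≡
    (proj₁ (passᵛˡ f r (lookup τ k)) , cells (τ [ k ]≔ proj₂ (passᵛˡ f r (lookup τ k))))
  passˡ-onTrack {zero}  k f r τ with [] ← lookup τ k = refl
  passˡ-onTrack {suc L} k f r τ
    rewrite passˡ-onTrack k f r (Vec.map Vec.tail τ) | Vec.lookup-map k Vec.head τ | Vec.lookup-map k Vec.tail τ
    with x ∷ xs ← lookup τ k
    = cong₂ _,_ refl (cong₂ _∷_ (sym (Vec.map-[]≔ Vec.head τ k)) (cong cells (sym (Vec.map-[]≔ Vec.tail τ k))))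

  -- A cell of a new track depends only on the same cell of the old tracks, so copying and clearing
  -- any number of tracks takes a single pass.
  Assignment : Set
  Assignment = Vec (Fin K ⊎ A) K

  assignCell : Assignment → Vec A K → Vec A K
  assignCell ρ c = Vec.map [ lookup c , id ]′ ρ

  assign : ∀ {L} → Assignment → Vec (Vec A L) K → Vec (Vec A L) K
  assign ρ τ = Vec.map [ lookup τ , replicate _ ]′ ρ

  passʳ-assign : ∀ {L} ρ (r : A) (τ : Vec (Vec A L) K) →
    passʳ (λ r c → r , assignCell ρ c) r (cells τ) ≡ (r , cells (assign ρ τ))
  passʳ-assign {zero}  ρ r τ = refl
  passʳ-assign {suc L} ρ r τ rewrite passʳ-assign ρ r (Vec.map Vec.tail τ) =
    cong (r ,_) (cong₂ _∷_ heads (cong cells tails))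
    where
    heads : assignCell ρ (Vec.map Vec.head τ) ≡ Vec.map Vec.head (assign ρ τ)
    heads = trans (Vec.map-cong (λ { (inj₁ j) → Vec.lookup-map j Vec.head τ ; (inj₂ a) → refl }) ρ)
      (Vec.map-∘ Vec.head _ ρ)
    tails : assign ρ (Vec.map Vec.tail τ) ≡ Vec.map Vec.tail (assign ρ τ)
    tails = trans (Vec.map-cong (λ { (inj₁ j) → Vec.lookup-map j Vec.tail τ ; (inj₂ a) → refl }) ρ)
      (Vec.map-∘ Vec.tail _ ρ)

  ℐ : Set → Set
  ℐ V = Instr V (Vec A K) A

  rightward leftward : {V : Set} → Fin K → Transducer → A → (A → V) → ℐ V
  rightward k f r₀ cont = sweep r₀ (onTrack k f) (nothing ,_) _,_ cont
  leftward  k f r₀ cont = sweep r₀ _,_ (nothing ,_) (onTrack k f) cont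

  assigning : {V : Set} → Assignment → V → ℐ V
  assigning ρ v = sweep zero (λ r c → r , assignCell ρ c) (nothing ,_) _,_ (λ _ → v)

  passˡ-id : {C R : Set} (r : R) (u : List C) → passˡ _,_ r u ≡ (r , u)
  passˡ-id r []      = refl
  passˡ-id r (c ∷ u) rewrite passˡ-id r u = refl

  passʳ-id : {C R : Set} (r : R) (u : List C) → passʳ _,_ r u ≡ (r , u)
  passʳ-id r []      = refl
  passʳ-id r (c ∷ u) rewrite passʳ-id r u = refl

  -- Counters: the least significant digit comes first.

  val : ∀ {L} → Vec A L → ℕ
  val []      = 0
  val (a ∷ v) = toℕ a + base * val v

  top : A
  top = Fin.fromℕ (suc β)

  -- The register holds the carry or borrow, zero once it is settled. `shift` exchanges register and
  -- letter, which delays the word by one cell: run to the right it pushes the initial register, run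
  -- to the left from zero it pops the top into the final register.
  incr decr shift : Transducer
  incr zero    a = zero , a
  incr (suc c) a with suc (toℕ a) ℕ.<? base
  ... | yes p = zero , fromℕ< p
  ... | no  _ = suc c , zero
  decr zero    a       = zero , a
  decr (suc c) zero    = suc c , top
  decr (suc c) (suc a) = zero , Fin.inject₁ a
  shift r a = a , r

  incr-zero : ∀ {L} (v : Vec A L) → passᵛʳ incr zero v ≡ (zero , v)
  incr-zero []      = refl
  incr-zero (a ∷ v) rewrite incr-zero v = refl

  decr-zero : ∀ {L} (v : Vec A L) → passᵛʳ decr zero v ≡ (zero , v)
  decr-zero []      = refl
  decr-zero (a ∷ v) rewrite decr-zero v = refl

  data Incremented {L} (v : Vec A L) : A × Vec A L → Set where
    overflow : ∀ {v′} → suc (val v) ≡ base ^ L → Incremented v (1F , v′)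
    ok       : ∀ {v′} → val v′ ≡ suc (val v) → Incremented v (0F , v′)

  -- A failed decrement doubles as the test for zero; the digits it leaves behind are unspecified.
  data Decremented {L} (v : Vec A L) : A × Vec A L → Set where
    borrow : ∀ {v′} → val v ≡ 0 → Decremented v (1F , v′)
    ok     : ∀ {v′} → val v ≡ suc (val v′) → Decremented v (0F , v′)

  increment : ∀ {L} (v : Vec A L) → Incremented v (passᵛʳ incr 1F v)
  increment []      = overflow refl
  increment {suc L} (a ∷ v) with suc (toℕ a) ℕ.<? base
  ... | yes p rewrite incr-zero v = ok (cong (_+ base * val v) (Fin.toℕ-fromℕ< p))
  ... | no ¬p with passᵛʳ incr 1F v | increment v
  ...   | _ | overflow e = overflow (trans (cong (_+ base * val v) full) (trans (sym (ℕ.*-suc base (val v))) (cong (base *_) e)))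
    where full = ℕ.≤-antisym (Fin.toℕ<n a) (ℕ.≮⇒≥ ¬p)
  ...   | _ | ok e = ok (trans (cong (base *_) e) (trans (ℕ.*-suc base (val v)) (cong (_+ base * val v) (sym full))))
    where full = ℕ.≤-antisym (Fin.toℕ<n a) (ℕ.≮⇒≥ ¬p)

  decrement : ∀ {L} (v : Vec A L) → Decremented v (passᵛʳ decr 1F v)
  decrement []            = borrow refl
  decrement (suc a ∷ v) rewrite decr-zero v = ok (cong (λ x → suc (x + base * val v)) (sym (Fin.toℕ-inject₁ a)))
  decrement (zero ∷ v) with passᵛʳ decr 1F v | decrement v
  ... | _ | borrow e = borrow (trans (cong (base *_) e) (ℕ.*-zeroʳ base))
  ... | _ | ok {v′} e   = ok (trans (cong (base *_) e) (trans (ℕ.*-suc base (val v′)) (cong (λ x → suc (x + base * val v′)) (sym (Fin.toℕ-fromℕ (suc β))))))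

  val-zero : ∀ L → val (replicate L 0F) ≡ 0
  val-zero zero    = refl
  val-zero (suc L) = trans (cong (base *_) (val-zero L)) (ℕ.*-zeroʳ base)

  val-top : ∀ L → suc (val (replicate L top)) ≡ base ^ L
  val-top zero    = refl
  val-top (suc L) = trans (cong (λ x → suc (x + base * val (replicate L top))) (Fin.toℕ-fromℕ (suc β)))
    (trans (sym (ℕ.*-suc base _)) (cong (base *_) (val-top L)))

  val< : ∀ {L} (v : Vec A L) → val v < base ^ L
  val< []      = s≤s z≤n
  val< (a ∷ v) = ℕ.≤-trans (ℕ.+-monoˡ-≤ _ (Fin.toℕ<n a)) (ℕ.≤-trans (ℕ.≤-reflexive (sym (ℕ.*-suc base _))) (ℕ.*-monoʳ-≤ base (val< v)))

  -- Stacks: the top comes first, and 0 fills the unused cells.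

  record Coding {G : Set} (blank : G) : Set where
    field
      enc     : G → Fin (suc β)
      dec     : A → G
      -- Popping an exhausted stack thus yields the blank, just as `writeMove` does beyond the
      -- visited cells.
      dec-0   : dec zero ≡ blank
      dec-enc : ∀ g → dec (suc (enc g)) ≡ g

  module Stacks {G : Set} {blank : G} (coding : Coding blank) where
    open Coding coding

    code : G → A
    code g = suc (enc g)

    data Stack : ∀ {L} → Vec A L → List G → Set where
      empty : ∀ {L} → Stack (replicate L zero) []
      _∷_   : ∀ {L} {v : Vec A L} {l} g → Stack v l → Stack (code g ∷ v) (g ∷ l)

    -- Stored symbols have nonzero codes and free cells hold 0, so the letter pushed out at the far
    -- end reveals whether the track was full.
    data Pushed {L} (g : G) (l : List G) : A × Vec A L → Set where
      overflow : ∀ {a v} → length l ≡ L → Pushed g l (suc a , v)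
      ok       : ∀ {v} → length l < L → Stack v (g ∷ l) → Pushed g l (zero , v)

    data Popped {L} : List G → A × Vec A L → Set where
      popped[] : ∀ {a v} → dec a ≡ blank → Stack v [] → Popped [] (a , v)
      popped∷  : ∀ {a v g l} → dec a ≡ g → Stack v l → Popped (g ∷ l) (a , v)

    private
      shift-zeros : ∀ L → passᵛʳ shift zero (replicate L zero) ≡ (zero , replicate L zero)
      shift-zeros zero    = refl
      shift-zeros (suc L) rewrite shift-zeros L = refl

      unshift-zeros : ∀ L → passᵛˡ shift zero (replicate L zero) ≡ (zero , replicate L zero)
      unshift-zeros zero    = refl
      unshift-zeros (suc L) rewrite unshift-zeros L = refl

      unshift : ∀ {L} {v : Vec A L} {l} → Stack v l →
                let r , v′ = passᵛˡ shift zero v in Stack (r ∷ v′) l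
      unshift {L} empty rewrite unshift-zeros L = empty {suc L}
      unshift (g ∷ s) = g ∷ unshift s

    push : ∀ {L} {v : Vec A L} {l} g → Stack v l → Pushed g l (passᵛʳ shift (code g) v)
    push {zero}  g empty   = overflow refl
    push {suc L} g empty   rewrite shift-zeros L = ok (s≤s z≤n) (g ∷ empty)
    push g (_∷_ {v = v} h s) with passᵛʳ shift (code h) v | push h s
    ... | _ | overflow e = overflow (cong suc e)
    ... | _ | ok lt s′   = ok (s≤s lt) (g ∷ s′)

    pop : ∀ {L} {v : Vec A L} {l} → Stack v l → Popped l (passᵛˡ shift zero v)
    pop {L} empty rewrite unshift-zeros L = popped[] dec-0 empty
    pop (g ∷ s) = popped∷ (dec-enc g) (unshift s)

    length-stack : ∀ {L} {v : Vec A L} {l} → Stack v l → length l ≤ L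
    length-stack empty   = z≤n
    length-stack (g ∷ s) = s≤s (length-stack s)

  to : {V : Set} → V → ℐ V
  to v = goto stay (v ∷ [])

  ifZero : {V : Set} → V → V → A → V
  ifZero v v′ zero    = v
  ifZero v v′ (suc _) = v′

  -- Moving the head of a tape kept on two tracks, after the symbol under it
  -- has been written: first a pop, then a push.
  popping : {V G : Set} → Fin K → Fin K → (A → G) → Dir → V → (G → V) → ℐ V
  popping l r dec left  v k = leftward l shift zero (k ∘ dec)
  popping l r dec stay  v k = to v
  popping l r dec right v k = leftward r shift zero (k ∘ dec)

  pushing : {V : Set} → V → Fin K → Fin K → A → Dir → V → ℐ V
  pushing reject l r a left  v = rightward r shift a (ifZero v reject)
  pushing reject l r a stay  v = goto stay []
  pushing reject l r a right v = rightward l shift a (ifZero v reject)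

-- Path counts of programs on tracks

Fits : {Γ : Set} → ℕ → Tape Γ → Set
Fits L (tape l _ r) = length l ≤ L × length r ≤ L

fits? : {Γ : Set} (L : ℕ) (t : Tape Γ) → Dec (Fits L t)
fits? L (tape l _ r) = (length l ≤? L) ×-dec (length r ≤? L)

module TrackRun {Σ V : Set} {β K : ℕ} (finiteV : Finite V) (start : V) (final : V → Bool)
  (instr : V → InputSymbol Σ → Tracks.ℐ β K V) where
  open Tracks β K

  sweeper : Sweeper Σ
  sweeper = record
    { V = V ; C = Vec A K ; R = A
    ; finiteV = finiteV ; finiteC = finite-Vec (finite-Fin _) K ; finiteR = finite-Fin _
    ; start = start ; final = final ; instr = instr }

  open Sweeping sweeper public using (machine)

  module Rules (w : List Σ) (B : ℕ) {L : ℕ} (room : 3 + L ≤ B) where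
    open Sweeping.Run sweeper w B public

    -- A datatype, to keep the underlying machine from being unfolded.
    data Reach (v : V) (i : ℕ) (τ : Vec (Vec A L) K) (n : ℕ) : Set where
      reach : At v i (cells τ) n → Reach v i τ n

    data Choices (i : ℕ) (τ : Vec (Vec A L) K) : List V → ℕ → Set where
      []  : Choices i τ [] 0
      _∷_ : ∀ {v vs m n} → Reach v i τ m → Choices i τ vs n → Choices i τ (v ∷ vs) (m + n)

    private
      room₃ : ∀ (τ : Vec (Vec A L) K) → 3 + length (cells τ) ≤ B
      room₃ τ = subst (λ l → 3 + l ≤ B) (sym (length-cells τ)) room

      room₂ : ∀ (τ : Vec (Vec A L) K) → 2 + length (cells τ) ≤ B
      room₂ τ = ℕ.≤-trans (ℕ.n≤1+n _) (room₃ τ)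

      alternatives : ∀ {i τ vs n} → Choices i τ vs n → Alternatives i (cells τ) vs n
      alternatives []             = []
      alternatives (reach t ∷ ts) = t ∷ alternatives ts

    reach-final : ∀ {v i τ} → T (final v) → Reach v i τ 1
    reach-final {τ = τ} fin = reach (at-final (room₂ τ) fin)

    reach-goto : ∀ {v i τ d vs n} → ¬ T (final v) → instr v (scan w i) ≡ goto d vs → Unique vs →
                 Choices (moveInput w d i) τ vs n → Reach v i τ n
    reach-goto {τ = τ} ¬fin eq uniq ts = reach (at-goto (room₂ τ) ¬fin eq uniq (alternatives ts))

    reach-dead : ∀ {v i τ d} → ¬ T (final v) → instr v (scan w i) ≡ goto d [] → Reach v i τ 0
    reach-dead ¬fin eq = reach-goto ¬fin eq [] []

    reach-jump : ∀ {v i τ d v′ n} → ¬ T (final v) → instr v (scan w i) ≡ goto d (v′ ∷ []) →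
                 Reach v′ (moveInput w d i) τ n → Reach v i τ n
    reach-jump {v} {i} {τ} {n = n} ¬fin eq t = subst (Reach v i τ) (ℕ.+-identityʳ n) (reach-goto ¬fin eq ([] ∷ []) (t ∷ []))

    reach-rightward : ∀ {v i τ k f r₀ cont n} → ¬ T (final v) → instr v (scan w i) ≡ rightward k f r₀ cont →
      let r , x = passᵛʳ f r₀ (lookup τ k) in Reach (cont r) i (τ [ k ]≔ x) n → Reach v i τ n
    reach-rightward {v} {i} {τ} {k} {f} {r₀} {cont} {n} ¬fin eq (reach t) = reach (at-sweep eq (room₃ τ) ¬fin
      (subst (λ (r , u) → At (cont r) i (u ++ []) n)
        (sym (trans (cong (λ (r , u) → passˡ _,_ r u) (passʳ-onTrack k f r₀ τ)) (passˡ-id _ _)))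
        (subst (λ u → At (cont (proj₁ (passᵛʳ f r₀ (lookup τ k)))) i u n) (sym (List.++-identityʳ _)) t)))

    reach-leftward : ∀ {v i τ k f r₀ cont n} → ¬ T (final v) → instr v (scan w i) ≡ leftward k f r₀ cont →
      let r , x = passᵛˡ f r₀ (lookup τ k) in Reach (cont r) i (τ [ k ]≔ x) n → Reach v i τ n
    reach-leftward {v} {i} {τ} {k} {f} {r₀} {cont} {n} ¬fin eq (reach t) = reach (at-sweep eq (room₃ τ) ¬fin
      (subst (λ (r , u) → At (cont r) i (u ++ []) n)
        (sym (trans (cong (λ (r , u) → passˡ (onTrack k f) r u) (passʳ-id r₀ (cells τ))) (passˡ-onTrack k f r₀ τ)))
        (subst (λ u → At (cont (proj₁ (passᵛˡ f r₀ (lookup τ k)))) i u n) (sym (List.++-identityʳ _)) t)))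

    reach-assigning : ∀ {v i τ ρ v′ n} → ¬ T (final v) → instr v (scan w i) ≡ assigning ρ v′ →
      Reach v′ i (assign ρ τ) n → Reach v i τ n
    reach-assigning {v} {i} {τ} {ρ} {v′} {n} ¬fin eq (reach t) = reach (at-sweep eq (room₃ τ) ¬fin
      (subst (λ (_ , u) → At v′ i (u ++ []) n)
        (sym (trans (cong (λ (r , u) → passˡ _,_ r u) (passʳ-assign ρ zero τ)) (passˡ-id _ _)))
        (subst (λ u → At v′ i u n) (sym (List.++-identityʳ _)) t)))

    module _ {reject : V} (¬final : ¬ T (final reject)) (dead : ∀ s → instr reject s ≡ goto stay [])
      {G : Set} {blank : G} (coding : Coding blank) where
      open Coding coding
      open Stacks coding

      -- The count `n` is prescribed by the continuation. A move that leaves the `L` cells makes the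
      -- push overflow into `reject`, so there `n` has to be 0. The equation `v₀ ≡ vt g` serves
      -- `stay`, where the written symbol remains under the head.
      reach-tape-move : ∀ {l r} → l ≢ r → ∀ {v v₀ i n} {vp vt : G → V} e {g} {τ : Vec (Vec A L) K} {tl x tr} →
        ¬ T (final v) → (∀ h → ¬ T (final (vp h))) →
        instr v (scan w i) ≡ popping l r dec e v₀ vp →
        (∀ h → instr (vp h) (scan w i) ≡ pushing reject l r (code g) e (vt h)) →
        v₀ ≡ vt g →
        Stack (lookup τ l) tl → Stack (lookup τ r) tr →
        let t = writeMove blank g e (tape tl x tr) in
         (∀ {vl vr} → Fits L t → Stack vl (Tape.before t) → Stack vr (Tape.after t) →
            Reach (vt (Tape.current t)) i (τ [ l ]≔ vl [ r ]≔ vr) n) →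
         (¬ Fits L t → n ≡ 0) →
        Reach v i τ n
      reach-tape-move {l} {r} l≢r {i = i} {n} {vp} {vt} left {g} {τ} {tl} {x} {tr} ¬f ¬fp ei ep ev sl sr good bad =
        reach-leftward {τ = τ} ¬f ei (popped (pop sl) good bad)
        where
        pushed : ∀ {h tl′ vl z} → Stack vl tl′ → Pushed g tr z →
          (∀ {vl vr} → Fits L (tape tl′ h (g ∷ tr)) → Stack vl tl′ → Stack vr (g ∷ tr) →
            Reach (vt h) i (τ [ l ]≔ vl [ r ]≔ vr) n) →
          (¬ Fits L (tape tl′ h (g ∷ tr)) → n ≡ 0) →
          Reach (ifZero (vt h) reject (proj₁ z)) i (τ [ l ]≔ vl [ r ]≔ proj₂ z) n
        pushed {vl = vl} s (overflow {v = v} e) good bad =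
          subst (Reach reject i (τ [ l ]≔ vl [ r ]≔ v)) (sym (bad λ (_ , lt) → ℕ.1+n≰n (subst (_≤ L) (cong suc e) lt)))
            (reach-dead {τ = τ [ l ]≔ vl [ r ]≔ v} ¬final (dead _))
        pushed s (ok lt s′) good bad = good (length-stack s , lt) s s′
        pushing-on : ∀ {h tl′ vl} → Stack vl tl′ →
          (∀ {vl vr} → Fits L (tape tl′ h (g ∷ tr)) → Stack vl tl′ → Stack vr (g ∷ tr) →
            Reach (vt h) i (τ [ l ]≔ vl [ r ]≔ vr) n) →
          (¬ Fits L (tape tl′ h (g ∷ tr)) → n ≡ 0) →
          Reach (vp h) i (τ [ l ]≔ vl) n
        pushing-on {h} {vl = vl} s good bad = reach-rightward {τ = τ [ l ]≔ vl} (¬fp h) (ep h)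
          (pushed s (push g (subst (λ v → Stack v tr) (sym (Vec.lookup∘update′ (l≢r ∘ sym) τ vl)) sr)) good bad)
        popped : ∀ {tl z} → Popped tl z →
          let t = writeMove blank g left (tape tl x tr) in
           (∀ {vl vr} → Fits L t → Stack vl (Tape.before t) → Stack vr (Tape.after t) →
              Reach (vt (Tape.current t)) i (τ [ l ]≔ vl [ r ]≔ vr) n) →
           (¬ Fits L t → n ≡ 0) →
           Reach (vp (dec (proj₁ z))) i (τ [ l ]≔ proj₂ z) n
        popped (popped[] e s) good bad rewrite e = pushing-on s good bad
        popped (popped∷ refl s) good bad = pushing-on s good bad
      reach-tape-move {l} {r} l≢r {i = i} {n} {vp} {vt} stay {g} {τ} ¬f ¬fp ei ep refl sl sr good bad =
        reach-jump {τ = τ} ¬f ei (subst (λ τ → Reach (vt g) i τ n)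
          (trans (cong (_[ r ]≔ lookup τ r) (Vec.[]≔-lookup τ l)) (Vec.[]≔-lookup τ r))
          (good (length-stack sl , length-stack sr) sl sr))
      reach-tape-move {l} {r} l≢r {i = i} {n} {vp} {vt} right {g} {τ} {tl} {x} {tr} ¬f ¬fp ei ep ev sl sr good bad =
        reach-leftward {τ = τ} ¬f ei (popped (pop sr) good bad)
        where
        pushed : ∀ {h tr′ vr z} → Stack vr tr′ → Pushed g tl z →
          (∀ {vl vr} → Fits L (tape (g ∷ tl) h tr′) → Stack vl (g ∷ tl) → Stack vr tr′ →
            Reach (vt h) i (τ [ l ]≔ vl [ r ]≔ vr) n) →
          (¬ Fits L (tape (g ∷ tl) h tr′) → n ≡ 0) →
          Reach (ifZero (vt h) reject (proj₁ z)) i (τ [ r ]≔ vr [ l ]≔ proj₂ z) n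
        pushed {vr = vr} s (overflow {v = v} e) good bad =
          subst (Reach reject i (τ [ r ]≔ vr [ l ]≔ v)) (sym (bad λ (lt , _) → ℕ.1+n≰n (subst (_≤ L) (cong suc e) lt)))
            (reach-dead {τ = τ [ r ]≔ vr [ l ]≔ v} ¬final (dead _))
        pushed {h} {vr = vr} s (ok {v} lt s′) good bad =
          subst (λ τ → Reach (vt h) i τ n) (Vec.[]≔-commutes τ l r l≢r) (good (lt , length-stack s) s′ s)
        pushing-on : ∀ {h tr′ vr} → Stack vr tr′ →
          (∀ {vl vr} → Fits L (tape (g ∷ tl) h tr′) → Stack vl (g ∷ tl) → Stack vr tr′ →
            Reach (vt h) i (τ [ l ]≔ vl [ r ]≔ vr) n) →
          (¬ Fits L (tape (g ∷ tl) h tr′) → n ≡ 0) →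
          Reach (vp h) i (τ [ r ]≔ vr) n
        pushing-on {h} {vr = vr} s good bad = reach-rightward {τ = τ [ r ]≔ vr} (¬fp h) (ep h)
          (pushed s (push g (subst (λ v → Stack v tl) (sym (Vec.lookup∘update′ l≢r τ vr)) sl)) good bad)
        popped : ∀ {tr z} → Popped tr z →
          let t = writeMove blank g right (tape tl x tr) in
           (∀ {vl vr} → Fits L t → Stack vl (Tape.before t) → Stack vr (Tape.after t) →
              Reach (vt (Tape.current t)) i (τ [ l ]≔ vl [ r ]≔ vr) n) →
           (¬ Fits L t → n ≡ 0) →
           Reach (vp (dec (proj₁ z))) i (τ [ r ]≔ proj₂ z) n
        popped (popped[] e s) good bad rewrite e = pushing-on s good bad
        popped (popped∷ refl s) good bad = pushing-on s good bad

-- The machine simulating M with oracle N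

module Program {Σ : Set} (finiteΣ : Finite Σ) (M : OracleTM Σ) (N : NTM Σ) (p₀ D β : ℕ)
  (codingM : Tracks.Coding (suc β) 12 (OracleTM.blank M))
  (codingN : Tracks.Coding (suc β) 12 (NTM.blank N)) where

  module M = OracleTM M
  module N = NTM N
  -- `suc β` guarantees a third letter, the filler 2 of the initial count; 12 is the number of
  -- tracks.
  open Tracks (suc β) 12
  module SM = Stacks codingM
  module SN = Stacks codingN

  pattern 10F = suc (suc (suc (suc (suc (suc (suc (suc (suc (suc zero)))))))))
  pattern 11F = suc 10F
  pattern 12F = suc 11F
  pattern 13F = suc 12F
  pattern 14F = suc 13F
  pattern 15F = suc 14F
  pattern 16F = suc 15F
  pattern 17F = suc 16F
  pattern 18F = suc 17F
  pattern 19F = suc 18F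
  pattern 20F = suc 19F
  pattern 21F = suc 20F
  pattern 22F = suc 21F
  pattern 23F = suc 22F
  pattern 24F = suc 23F
  pattern 25F = suc 24F
  pattern 26F = suc 25F
  pattern 27F = suc 26F
  pattern 28F = suc 27F
  pattern 29F = suc 28F
  pattern 30F = suc 29F

  -- The tracks: the configuration of M after its latest query (stacks, head
  -- position), the current configuration of M (stacks; its head is the actual
  -- head) and a scratch counter, a configuration of N (stacks, head position),
  -- a position on the oracle tape, and two clocks.
  pattern savedL = 0F
  pattern savedR = 1F
  pattern savedH = 2F
  pattern currL  = 3F
  pattern currR  = 4F
  pattern seekH  = 5F
  pattern simL   = 6F
  pattern simR   = 7F
  pattern simH   = 8F
  pattern target = 9F
  pattern clock₁ = 10F
  pattern clock₂ = 11F

  -- State and scanned work symbol of M after its latest query.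
  Saved : Set
  Saved = M.Q × M.Γ

  -- M is run from the saved configuration up to its next query: to see whether
  -- there is one, to find a symbol of the query for N, or to get past the query.
  Mode : Set
  Mode = Maybe (Bool × Maybe (Fin (2 + p₀) × N.Q × N.Γ))

  pattern probe         = nothing
  pattern advance b     = just (b , nothing)
  pattern fetch b c q g = just (b , just (c , q , g))

  -- The control states form a sum of 31 finite families, so that finiteness is read off the
  -- entries; the patterns below name the families in this order.
  labels : Vec (∃ Finite) 31
  labels =
      (_ , finite-⊤)
    ∷ (_ , finite-Fin (suc D))
    ∷ (_ , finite-⊤)
    ∷ (_ , finite-⊤)
    ∷ (_ , running)
    ∷ (_ , running)
    ∷ (_ , running)
    ∷ (_ , running)
    ∷ (_ , finite-× running saved)
    ∷ (_ , finite-× running pending)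
    ∷ (_ , finite-× running pending)
    ∷ (_ , finite-× running (finite-× pending M.finiteΓ))
    ∷ (_ , finite-× running (finite-× saved (finite-Maybe finiteΣ)))
    ∷ (_ , saved)
    ∷ (_ , saved)
    ∷ (_ , sim)
    ∷ (_ , finite-× finite-Bool (finite-× (finite-Σ (2 + p₀) (λ c → finite-Fin (toℕ c))) saved))
    ∷ (_ , sim)
    ∷ (_ , finite-× sim simulated)
    ∷ (_ , finite-× sim simulated)
    ∷ (_ , finite-× sim (finite-× simulated (finite-InputSymbol finiteΣ)))
    ∷ (_ , finite-× sim (finite-× (finite-Action N.finiteQ N.finiteΓ) (finite-InputSymbol finiteΣ)))
    ∷ (_ , finite-× sim (finite-Action N.finiteQ N.finiteΓ))
    ∷ (_ , finite-× sim (finite-× (finite-Action N.finiteQ N.finiteΓ) N.finiteΓ))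
    ∷ (_ , sim)
    ∷ (_ , saved)
    ∷ (_ , saved)
    ∷ (_ , saved)
    ∷ (_ , saved)
    ∷ (_ , finite-⊤)
    ∷ (_ , finite-⊤)
    ∷ []
    where
    saved     = finite-× M.finiteQ M.finiteΓ
    simulated = finite-× N.finiteQ N.finiteΓ
    sim       = finite-× finite-Bool (finite-× (finite-Fin (2 + p₀)) saved)
    running   = finite-× (finite-Maybe (finite-× finite-Bool (finite-Maybe (finite-× (finite-Fin (2 + p₀)) simulated)))) saved
    pending   = finite-× M.finiteQ (finite-× M.finiteΓ (finite-× finite-Dir (finite-Maybe finiteΣ)))

  V : Set
  V = ∃ λ i → proj₁ (lookup labels i)

  abstract
    finiteV : Finite V
    finiteV = finite-Σ 31 (λ i → proj₂ (lookup labels i))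

  pattern Count             = 0F , tt
  pattern Fill d            = 1F , d
  pattern Onward            = 2F , tt
  pattern Prepare           = 3F , tt
  pattern Reset m x         = 4F , m , x
  pattern Rewind m x        = 5F , m , x
  pattern Seek m x          = 6F , m , x
  pattern SeekNext m x      = 7F , m , x
  pattern RunM m x q g      = 8F , (m , x) , q , g
  pattern Tick m x z        = 9F , (m , x) , z
  pattern PopM m x z        = 10F , (m , x) , z
  pattern PushM m x z g     = 11F , (m , x) , z , g
  pattern Emit m x q g o    = 12F , (m , x) , (q , g) , o
  pattern Ask x             = 13F , x
  pattern Guess x           = 14F , x
  pattern Phase b c x       = 15F , b , c , x
  pattern Free b c i x      = 16F , b , (c , i) , x
  pattern StartN b c x      = 17F , b , c , x
  pattern LoadN b c x q g   = 18F , (b , c , x) , q , g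
  pattern TestN b c x q g   = 19F , (b , c , x) , q , g
  pattern StepN b c x q g s = 20F , (b , c , x) , (q , g) , s
  pattern HeadN b c x a s   = 21F , (b , c , x) , a , s
  pattern PopN b c x a      = 22F , (b , c , x) , a
  pattern PushN b c x a g   = 23F , (b , c , x) , a , g
  pattern EndPhase b c x    = 24F , b , c , x
  pattern Save x            = 25F , x
  pattern Measure x         = 26F , x
  pattern MeasureInc x      = 27F , x
  pattern MeasureNext x     = 28F , x
  pattern Reject            = 29F , tt
  pattern Accept            = 30F , tt

  final : V → Bool
  final (30F , _) = true
  final _         = false

  preparing resetting starting testing saving : Assignment
  preparing = replicate 12 (inj₂ 0F) [ clock₁ ]≔ inj₂ top
  resetting = tabulate inj₁ [ currL ]≔ inj₁ savedL [ currR ]≔ inj₁ savedR [ seekH ]≔ inj₁ savedH [ clock₂ ]≔ inj₂ top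
  starting  = tabulate inj₁ [ simL ]≔ inj₂ 0F [ simR ]≔ inj₂ 0F [ simH ]≔ inj₂ 0F
  testing   = tabulate inj₁ [ target ]≔ inj₁ simH
  saving    = tabulate inj₁ [ savedL ]≔ inj₁ currL [ savedR ]≔ inj₁ currR [ savedH ]≔ inj₂ 0F

  -- During the initial count the digits are interspersed with fillers 2, which
  -- are skipped.
  incr₂ : Transducer
  incr₂ zero    a    = zero , a
  incr₂ (suc c) 0F   = zero , 1F
  incr₂ (suc c) 1F   = suc c , 0F
  incr₂ (suc c) a    = suc c , a

  countCell : A → Vec A 12
  countCell a = replicate 12 0F [ target ]≔ a

  overflowing : A → Maybe (Vec A 12) × A
  overflowing zero    = nothing , zero
  overflowing (suc c) = just (countCell 1F) , suc c

  answer : Bool → M.Q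
  answer b = if b then M.yes else M.no

  exit : Mode → Saved → M.Γ → V
  exit probe           x g = Ask x
  exit (advance b)     x g = Save (answer b , g)
  -- `M` has reached its query before the wanted position, so the head of `N` stands on the right
  -- endmarker.
  exit (fetch b c q h) x g = StepN b c x q h ⊣

  halted : Mode → Bool → V
  halted probe true = Accept
  halted _     _    = Reject

  runningM : Mode → Saved → M.Γ → ∀ {q} → Dec (q ≡ M.query) → Maybe (Action M.Q M.Γ × Maybe Σ) → ℐ V
  runningM m x g         (yes _) _                            = to (exit m x g)
  runningM m x g {q = q} (no _)  nothing                      = to (halted m (M.accept q))
  runningM m x g         (no _)  (just (action q h d e , o)) = goto d (Tick m x (q , h , e , o) ∷ [])

  emitting : Mode → Saved → M.Q → M.Γ → Maybe Σ → ℐ V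
  emitting m@(fetch b c q′ g′) x q g (just a) = rightward target decr 1F (ifZero (RunM m x q g) (StepN b c x q′ g′ (char a)))
  emitting m                   x q g _        = to (RunM m x q g)

  loadN : Bool → V → V → ℐ V
  loadN true  v v′ = to v
  loadN false v v′ = assigning testing v′

  -- The length of the query is not known, so the simulated head is stopped at the ends by the
  -- symbol it scans, not by its position.
  headN : Dir → InputSymbol Σ → V → ℐ V
  headN left  ⊢ v = to v
  headN left  _ v = rightward simH decr 1F (λ _ → v)
  headN stay  _ v = to v
  headN right ⊣ v = to v
  headN right _ v = rightward simH incr 1F (ifZero v Reject)

  instr : V → InputSymbol Σ → ℐ V
  -- A carry beyond the last digit appends a new leading 1, and `D` fillers follow it: every binary
  -- digit ends up occupying `D + 1` cells.
  instr Count s = sweep 1F (onTrack target incr₂) overflowing _,_ (ifZero Onward (Fill (Fin.fromℕ D)))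
  instr (Fill zero) s = to Onward
  instr (Fill (suc d)) s = sweep 0F _,_ (just (countCell 2F) ,_) _,_ (λ _ → Fill (Fin.inject₁ d))
  instr Onward ⊣ = to Prepare
  instr Onward _ = goto right (Count ∷ [])
  instr Prepare s = assigning preparing (Reset probe (M.start , M.blank))
  instr (Reset m x) s =
    assigning resetting (Rewind m x)
  instr (Rewind m x) ⊢ = to (Seek m x)
  instr (Rewind m x) _ = goto left (Rewind m x ∷ [])
  instr (Seek m (q , g)) s = rightward seekH decr 1F (ifZero (SeekNext m (q , g)) (RunM m (q , g) q g))
  instr (SeekNext m x) s = goto right (Seek m x ∷ [])
  instr (RunM m x q g) s = runningM m x g (decEq M.finiteQ q M.query) (M.δ q s g)
  instr (Tick m x z) s = rightward clock₂ decr 1F (ifZero (PopM m x z) Reject)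
  instr (PopM m x (q , h , e , o)) s =
    popping currL currR (Coding.dec codingM) e (Emit m x q h o) (PushM m x (q , h , e , o))
  instr (PushM m x (q , h , e , o) g) s = pushing Reject currL currR (SM.code h) e (Emit m x q g o)
  instr (Emit m x q g o) s = emitting m x q g o
  instr (Ask x) s = rightward clock₁ decr 1F (ifZero (Guess x) Reject)
  instr (Guess x) s = goto stay (Phase true 0F x ∷ Phase false (Fin.fromℕ (suc p₀)) x ∷ [])
  instr (Phase b c x) s = goto stay (StartN b c x ∷ List.map (λ i → Free b c i x) (List.allFin (toℕ c)))
  instr (Free b c i x) s = to (EndPhase b c x)
  instr (StartN b c x) s =
    assigning starting (LoadN b c x N.start N.blank)
  instr (LoadN b c x q g) s =
    loadN (N.accept q) (EndPhase b c x) (TestN b c x q g)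
  -- Position 0 is the left endmarker and needs no rerun of `M`; otherwise the decremented position
  -- is the index of the wanted letter of the query.
  instr (TestN b c x q g) s = rightward target decr 1F (ifZero (Reset (fetch b c q g) x) (StepN b c x q g ⊢))
  instr (StepN b c x q g a) s = goto stay (List.map (λ z → HeadN b c x z a) (enabledActions N q a g))
  instr (HeadN b c x z a) s = headN (Action.inputDir z) a (PopN b c x z)
  instr (PopN b c x z@(action q h _ e)) s = popping simL simR (Coding.dec codingN) e (LoadN b c x q h) (PushN b c x z)
  instr (PushN b c x (action q h _ e) g) s = pushing Reject simL simR (SN.code h) e (LoadN b c x q g)
  -- The phase with one free choice is the last one of a no; a yes consists of the single phase 0.
  instr (EndPhase b (suc (suc c)) x) s = to (Phase b (Fin.inject₁ (suc c)) x)
  instr (EndPhase b _ x) s = to (Reset (advance b) x)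
  instr (Save x) s =
    assigning saving (Measure x)
  -- The current head position of `M` exists only as the actual input head; it is recorded by
  -- counting the steps back to the left endmarker.
  instr (Measure x) ⊢ = to (Reset probe x)
  instr (Measure x) _ = to (MeasureInc x)
  instr (MeasureInc x) s = rightward savedH incr 1F (ifZero (MeasureNext x) Reject)
  instr (MeasureNext x) s = goto left (Measure x ∷ [])
  instr Reject s = goto stay []
  instr Accept s = goto stay []

  open TrackRun finiteV Count final instr public using (machine)

-- Running M up to its next query

look : {Σ : Set} → List Σ → ℕ → InputSymbol Σ
look []      _       = ⊣
look (a ∷ _) zero    = char a
look (_ ∷ v) (suc j) = look v j

mutual
  scan-look : {Σ : Set} (w : List Σ) (i : ℕ) → scan w (suc i) ≡ look w i
  scan-look []      i       = refl
  scan-look (a ∷ v) zero    = refl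
  scan-look {Σ} (a ∷ v) (suc j) with a ∷ v | suc j
  ... | x | y = scan-look-from Σ x y v j

  -- The left-hand side is the auxiliary function local to scan, which keeps
  -- the arguments x and y of scan and cannot be named here.
  scan-look-from : (Σ : Set) (x : List Σ) (y : ℕ) (v : List Σ) (j : ℕ) → _ ≡ look v j
  scan-look-from Σ x y []      j       = refl
  scan-look-from Σ x y (a ∷ v) zero    = refl
  scan-look-from Σ x y (a ∷ v) (suc j) = scan-look-from Σ x y v j

scan-∷ : {Σ : Set} (a : Σ) (y : List Σ) (j : ℕ) → scan (a ∷ y) (suc (suc j)) ≡ scan y (suc j)
scan-∷ a y j = trans (scan-look (a ∷ y) (suc j)) (sym (scan-look y j))

look≢⊢ : {Σ : Set} (w : List Σ) (i : ℕ) → look w i ≢ ⊢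
look≢⊢ (a ∷ v) (suc j) e = look≢⊢ v j e

scan≢⊢ : {Σ : Set} (w : List Σ) (i : ℕ) → scan w (suc i) ≢ ⊢
scan≢⊢ w i e = look≢⊢ w i (trans (sym (scan-look w i)) e)

look-⊣ : {Σ : Set} (w : List Σ) (i : ℕ) → look w i ≡ ⊣ → length w ≤ i
look-⊣ []      i       e = z≤n
look-⊣ (a ∷ w) (suc i) e = s≤s (look-⊣ w i e)

look-≥ : {Σ : Set} (w : List Σ) (i : ℕ) → length w ≤ i → look w i ≡ ⊣
look-≥ []      i       l       = refl
look-≥ (a ∷ w) (suc i) (s≤s l) = look-≥ w i l

moveInput-≤ : {Σ : Set} (w : List Σ) (d : Dir) {i : ℕ} → i ≤ suc (length w) → moveInput w d i ≤ suc (length w)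
moveInput-≤ w left  l = ℕ.≤-trans (ℕ.pred[n]≤n) l
moveInput-≤ w stay  l = l
moveInput-≤ w right l = ℕ.m⊓n≤n _ _

moveInput-right : {Σ : Set} (w : List Σ) {i : ℕ} → i ≤ length w → moveInput w right i ≡ suc i
moveInput-right w l = ℕ.m≤n⇒m⊓n≡m (s≤s l)

scan≢⊣ : {Σ : Set} (w : List Σ) (i : ℕ) → i ≤ length w → scan w i ≢ ⊣
scan≢⊣ w zero    l ()
scan≢⊣ w (suc i) l e = ℕ.<⇒≱ l (look-⊣ w i (trans (sym (scan-look w i)) e))

right-at-end : {Σ : Set} (y : List Σ) (j : ℕ) → scan y j ≡ ⊣ → j ≤ suc (length y) → moveInput y right j ≡ j
right-at-end y (suc j) e b = trans (ℕ.m≥n⇒m⊓n≡n (ℕ.≤-trans (s≤s end) (ℕ.n≤1+n _))) (sym (ℕ.≤-antisym b (s≤s end)))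
  where end = look-⊣ y j (trans (sym (scan-look y j)) e)

right-inside : {Σ : Set} (y : List Σ) (j : ℕ) → scan y j ≢ ⊣ → moveInput y right j ≡ suc j
right-inside y zero    ¬e = refl
right-inside y (suc j) ¬e = moveInput-right y (ℕ.≰⇒> λ l → ¬e (trans (scan-look y j) (look-≥ y j l)))

⊣? : {Σ : Set} (s : InputSymbol Σ) → Dec (s ≡ ⊣)
⊣? ⊢        = no λ ()
⊣? ⊣        = yes refl
⊣? (char _) = no λ ()

module OracleRuns {Σ : Set} (M : OracleTM Σ) (w : List Σ) (L : ℕ) where
  private
    module M = OracleTM M

  ConfigM : Set
  ConfigM = Config M.Q M.Γ

  data Result : Set where
    dead accept : Result
    query       : ConfigM → List Σ → Result

  output : Maybe Σ → Result → Result
  output o dead        = dead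
  output o accept      = accept
  output o (query c y) = query c (fromMaybe o ++ y)

  -- The outcome of at most k steps of M up to its next query, and the word
  -- written on the oracle tape meanwhile; configurations that do not fit into
  -- L cells are dead.
  mutual
    run : ℕ → ConfigM → Result
    run k c = examine k c (decEq M.finiteQ (state c) M.query) (M.δ (state c) (scan w (head c)) (Tape.current (work c)))

    examine : ℕ → (c : ConfigM) → Dec (state c ≡ M.query) → Maybe (Action M.Q M.Γ × Maybe Σ) → Result
    examine k       c (yes _) _              = query c []
    examine k       c (no _)  nothing        = if M.accept (state c) then accept else dead
    examine zero    c (no _)  (just _)       = dead
    examine (suc k) c (no _)  (just (a , o)) = proceed k (perform M.blank w a c) o (fits? L (work (perform M.blank w a c)))

    proceed : ℕ → (c : ConfigM) → Maybe Σ → Dec (Fits L (work c)) → Result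
    proceed k c o (yes _) = output o (run k c)
    proceed k c o (no _)  = dead

module RunCorrect {Σ : Set} (finiteΣ : Finite Σ) (M : OracleTM Σ) (N : NTM Σ) (p₀ D β : ℕ)
  (codingM : Tracks.Coding (suc β) 12 (OracleTM.blank M))
  (codingN : Tracks.Coding (suc β) 12 (NTM.blank N))
  (w : List Σ) (B L : ℕ) (room : 3 + L ≤ B) (wide : 2 + length w ≤ (3 + β) ^ L) where

  open Program finiteΣ M N p₀ D β codingM codingN
  open Tracks (suc β) 12
  open TrackRun {Σ = Σ} finiteV Count final instr using (module Rules)
  open Rules w B room public
  open OracleRuns M w L public

  Track : Set
  Track = Vec A L

  reach-reject : ∀ {i τ} → Reach Reject i τ 0
  reach-reject {i} {τ} = reach-dead {τ = τ} id refl


  fuel : ℕ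
  fuel = val (replicate L top)

  module _ (sL sR sH nL nR nH k₁ : Track) where

    store : Track → Track → Track → Track → Track → Vec Track 12
    store cL cR h t k₂ = sL ∷ sR ∷ sH ∷ cL ∷ cR ∷ h ∷ nL ∷ nR ∷ nH ∷ t ∷ k₁ ∷ k₂ ∷ []

    -- What has to be shown about the continuation when M is run.
    Outcome : Mode → Saved → Result → ℕ → ℕ → Set
    Outcome probe x dead   t n = n ≡ 0
    Outcome probe x accept t n = n ≡ 1
    Outcome probe x (query c y) t n = ∀ {cL cR h t k₂} → Reach (Ask x) (head c) (store cL cR h t k₂) n
    Outcome (advance b) x (query c y) t n = ∀ {cL cR h t k₂} →
      SM.Stack cL (Tape.before (work c)) → SM.Stack cR (Tape.after (work c)) →
      Reach (exit (advance b) x (Tape.current (work c))) (head c) (store cL cR h t k₂) n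
    Outcome (fetch b c q g) x (query _ y) t n = ∀ {i cL cR h t′ k₂} →
      Reach (StepN b c x q g (scan y (suc t))) i (store cL cR h t′ k₂) n
    -- Letters are fetched and answers taken only after a probe has seen `M` reach a query from the
    -- same configuration, so no other result can occur in these modes.
    Outcome _ x _ t n = ⊥

    outcome-dead : ∀ m x {t n} → Outcome m x dead t n → n ≡ 0
    outcome-dead probe x e = e
    outcome-dead (advance _) x ()
    outcome-dead (fetch _ _ _ _) x ()

    -- Prepending the emitted symbol shifts the wanted position by one, which the decrement of
    -- `target` follows; a borrow means that the emitted symbol itself is wanted.
    emit-correct : ∀ m x {q g o i cL cR h t k₂ n} r → Outcome m x (output o r) (val t) n →
      (∀ {t′} → Outcome m x r (val t′) n → Reach (RunM m x q g) i (store cL cR h t′ k₂) n) →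
      Reach (Emit m x q g o) i (store cL cR h t k₂) n
    emit-correct probe x r@dead O k = reach-jump id refl (k O)
    emit-correct probe x r@accept O k = reach-jump id refl (k O)
    emit-correct probe x r@(query _ _) O k = reach-jump id refl (k O)
    emit-correct (advance b) x (query _ _) O k = reach-jump id refl (k O)
    emit-correct (fetch b c q g) x {o = nothing} (query _ _) O k = reach-jump id refl (k O)
    emit-correct (fetch b c q g) x {o = just a} {t = t} (query _ y) O k = reach-rightward id refl (found (decrement t) O k)
      where
      found : ∀ {q′ g′ i cL cR h k₂ n z} → Decremented t z →
        (∀ {i cL cR h t′ k₂} → Reach (StepN b c x q g (scan (a ∷ y) (suc (val t)))) i (store cL cR h t′ k₂) n) →
        (∀ {t′} → (∀ {i cL cR h t″ k₂} → Reach (StepN b c x q g (scan y (suc (val t′)))) i (store cL cR h t″ k₂) n) →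
           Reach (RunM (fetch b c q g) x q′ g′) i (store cL cR h t′ k₂) n) →
        Reach (ifZero (RunM (fetch b c q g) x q′ g′) (StepN b c x q g (char a)) (proj₁ z)) i (store cL cR h (proj₂ z) k₂) n
      found {i = i} {cL} {cR} {h} {k₂} {n} (borrow {v} e) O k =
        subst (λ j → Reach (StepN b c x q g (scan (a ∷ y) (suc j))) i (store cL cR h v k₂) n) e O
      found {n = n} (ok {t′} e) O k = k λ {i} {cL} {cR} {h} {t″} {k₂} → subst (λ s → Reach (StepN b c x q g s) i (store cL cR h t″ k₂) n)
        (trans (cong (λ j → scan (a ∷ y) (suc j)) e) (scan-∷ a y (val t′))) O

    mutual
      -- The machine and `run` fail together: `k` is the value of `clock₂`, which drops by one per
      -- step, and a stack overflows exactly when `Fits` fails.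
      run-correct : ∀ k m x c {cL cR h t k₂ n} → k ≡ val k₂ →
        SM.Stack cL (Tape.before (work c)) → SM.Stack cR (Tape.after (work c)) →
        Outcome m x (run k c) (val t) n →
        Reach (RunM m x (state c) (Tape.current (work c))) (head c) (store cL cR h t k₂) n
      run-correct k m x c e sl sr O = examine-correct k m x c
        (decEq M.finiteQ (state c) M.query) (M.δ (state c) (scan w (head c)) (Tape.current (work c))) e sl sr refl O

      examine-correct : ∀ k m x c d r {cL cR h t k₂ n} → k ≡ val k₂ →
        SM.Stack cL (Tape.before (work c)) → SM.Stack cR (Tape.after (work c)) →
        instr (RunM m x (state c) (Tape.current (work c))) (scan w (head c)) ≡ runningM m x (Tape.current (work c)) d r →
        Outcome m x (examine k c d r) (val t) n →
        Reach (RunM m x (state c) (Tape.current (work c))) (head c) (store cL cR h t k₂) n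
      examine-correct k probe x c (yes _) r e sl sr eq O = reach-jump id eq O
      examine-correct k (advance b) x c (yes _) r e sl sr eq O = reach-jump id eq (O sl sr)
      examine-correct k (fetch _ _ _ _) x c (yes _) r e sl sr eq O = reach-jump id eq O
      examine-correct k probe x c (no _) nothing e sl sr eq O = reach-jump id eq (halt (M.accept (state c)) O)
        where
        halt : ∀ b {i τ t n} → Outcome probe x (if b then accept else dead) t n → Reach (halted probe b) i τ n
        halt true  refl = reach-final tt
        halt false refl = reach-reject
      examine-correct k m@(advance _) x c (no _) nothing e sl sr eq O = ⊥-elim (unhalted (M.accept (state c)) O)
        where
        unhalted : ∀ b {t n} → ¬ Outcome m x (if b then accept else dead) t n
        unhalted true  ()
        unhalted false ()
      examine-correct k m@(fetch _ _ _ _) x c (no _) nothing e sl sr eq O = ⊥-elim (unhalted (M.accept (state c)) O)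
        where
        unhalted : ∀ b {t n} → ¬ Outcome m x (if b then accept else dead) t n
        unhalted true  ()
        unhalted false ()
      examine-correct k m x c (no _) (just (a , o)) {k₂ = k₂} e sl sr eq O =
        reach-jump id eq (reach-rightward id refl (tick-correct k m x c a o (decrement k₂) e sl sr O))

      tick-correct : ∀ k m x c a o {¬q cL cR h t k₂ n z} → Decremented k₂ z → k ≡ val k₂ →
        SM.Stack cL (Tape.before (work c)) → SM.Stack cR (Tape.after (work c)) →
        Outcome m x (examine k c (no ¬q) (just (a , o))) (val t) n →
        Reach (ifZero (PopM m x (Action.next a , Action.write a , Action.workDir a , o)) Reject (proj₁ z))
          (moveInput w (Action.inputDir a) (head c)) (store cL cR h t (proj₂ z)) n
      tick-correct zero m x c a o (borrow e) _ sl sr O = subst (Reach Reject _ _) (sym (outcome-dead m x O)) reach-reject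
      tick-correct zero m x c a o (ok e) e′ sl sr O = contradiction (trans e′ e) λ ()
      tick-correct (suc k) m x c a o (borrow e) e′ sl sr O = contradiction (trans e′ e) λ ()
      tick-correct (suc k) m x c a o {t = t} (ok {k₂′} e) e′ sl sr O =
        reach-tape-move id (λ _ → refl) codingM {l = currL} {r = currR} (λ ()) (Action.workDir a) id (λ _ → id) refl (λ _ → refl) refl sl sr
          (λ fits sl′ sr′ → moved (fits? L (work c′)) fits sl′ sr′ O)
          (λ ¬fits → unfit (fits? L (work c′)) ¬fits O)
        where
        c′ = perform M.blank w a c
        unfit : ∀ {n} (d : Dec (Fits L (work c′))) → ¬ Fits L (work c′) → Outcome m x (proceed k c′ o d) (val t) n → n ≡ 0
        unfit (yes f) ¬f O = contradiction f ¬f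
        unfit (no _)  ¬f O = outcome-dead m x O
        moved : ∀ {cL cR h n} (d : Dec (Fits L (work c′))) → Fits L (work c′) →
          SM.Stack cL (Tape.before (work c′)) → SM.Stack cR (Tape.after (work c′)) →
          Outcome m x (proceed k c′ o d) (val t) n →
          Reach (Emit m x (Action.next a) (Tape.current (work c′)) o) (head c′) (store cL cR h t k₂′) n
        moved (no ¬f) f sl sr O = contradiction f ¬f
        moved (yes _) f sl sr O = emit-correct m x (run k c′) O
          (run-correct k m x c′ (ℕ.suc-injective (trans e′ e)) sl sr)

    rewind-correct : ∀ {m x τ n} i → Reach (Seek m x) 0 τ n → Reach (Rewind m x) i τ n
    rewind-correct zero    t = reach-jump id refl t
    rewind-correct {m} {x} (suc i) t = reach-jump id (turn _ (scan≢⊢ w i)) (rewind-correct i t)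
      where
      turn : ∀ s → s ≢ ⊢ → instr (Rewind m x) s ≡ goto left (Rewind m x ∷ [])
      turn ⊢        ¬e = contradiction refl ¬e
      turn ⊣        ¬e = refl
      turn (char _) ¬e = refl

    mutual
      seek-correct : ∀ {m q g cL cR t k₂ n} d j {h} → val h ≡ d → j + d ≤ suc (length w) →
        (∀ {h} → Reach (RunM m (q , g) q g) (j + d) (store cL cR h t k₂) n) →
        Reach (Seek m (q , g)) j (store cL cR h t k₂) n
      seek-correct d j {h} e b k = reach-rightward id refl (sought d j (decrement h) e b k)

      sought : ∀ {m q g cL cR t k₂ n} d j {h z} → Decremented h z → val h ≡ d → j + d ≤ suc (length w) →
        (∀ {h} → Reach (RunM m (q , g) q g) (j + d) (store cL cR h t k₂) n) →
        Reach (ifZero (SeekNext m (q , g)) (RunM m (q , g) q g) (proj₁ z)) j (store cL cR (proj₂ z) t k₂) n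
      sought zero j (borrow _) e b k = subst (λ j → Reach _ j _ _) (ℕ.+-identityʳ j) k
      sought zero j (ok e′) e b k = contradiction (trans (sym e) e′) λ ()
      sought (suc d) j (borrow e′) e b k = contradiction (trans (sym e) e′) λ ()
      sought {m} {q} {g} {cL} {cR} {t} {k₂} {n} (suc d) j (ok {h′} e′) e b k = reach-jump id refl
        (subst (λ j → Reach (Seek m (q , g)) j (store cL cR h′ t k₂) n) (sym (moveInput-right w (ℕ.≤-pred (ℕ.≤-trans (s≤s (ℕ.m≤m+n j d)) b′))))
          (seek-correct d (suc j) (ℕ.suc-injective (trans (sym e′) e)) b′
            (λ {h} → subst (λ j → Reach (RunM m (q , g) q g) j (store cL cR h t k₂) n) (ℕ.+-suc j d) k)))
        where b′ = subst (_≤ suc (length w)) (ℕ.+-suc j d) b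

    reset-correct : ∀ m σ {i cL cR h t k₂ n} →
      SM.Stack sL (Tape.before (work σ)) → SM.Stack sR (Tape.after (work σ)) →
      val sH ≡ head σ → head σ ≤ suc (length w) →
      Outcome m (state σ , Tape.current (work σ)) (run fuel σ) (val t) n →
      Reach (Reset m (state σ , Tape.current (work σ))) i (store cL cR h t k₂) n
    reset-correct m σ {i} {cL} {cR} {h} {t} {k₂} sl sr e b O = reach-assigning {τ = store cL cR h t k₂} {ρ = resetting} id refl
      (rewind-correct {τ = store sL sR sH t (replicate L top)} i
        (seek-correct (head σ) 0 e b (run-correct fuel m _ σ refl sl sr O)))

-- Simulating N on a query

module Simulated {Σ : Set} (N : NTM Σ) (y : List Σ) (L H : ℕ) where
  open NTM N

  private
    ConfigN = Config Q Γ
    after : Action Q Γ → ConfigN → ConfigN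
    after = perform blank y

  Allowed : ConfigN → Set
  Allowed d = Fits L (work d) × head d < H

  allowed? : ∀ d → Dec (Allowed d)
  allowed? d = fits? L (work d) ×-dec (head d ℕ.<? H)

  -- The computation tree of N on y, pruned where a configuration is too large.
  mutual
    data Tree (d : ConfigN) : ℕ → Set where
      accepting : accept (state d) ≡ true → Tree d 1
      branching : ∀ {n} → accept (state d) ≡ false →
        Trees d (enabledActions N (state d) (scan y (head d)) (Tape.current (work d))) n → Tree d n

    data Trees (d : ConfigN) : List (Action Q Γ) → ℕ → Set where
      []    : Trees d [] 0
      grow  : ∀ {a} {as : List (Action Q Γ)} {m n} → Allowed (after a d) → Tree (after a d) m → Trees d as n → Trees d (a ∷ as) (m + n)
      prune : ∀ {a} {as : List (Action Q Γ)} {n} → ¬ Allowed (after a d) → Trees d as n → Trees d (a ∷ as) n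

  mutual
    -- By recursion on the halting of `N`, which is given for every word. So there is a count even
    -- for a query after a wrong guess, where `N` may outgrow the `L` cells; pruned branches
    -- contribute 0.
    tree : ∀ {d} → Acc (flip (_⟶_ N y)) d → ∃ (Tree d)
    tree {d} a with accept (state d) in eq
    ... | true  = 1 , accepting eq
    ... | false = let n , ts = trees a (enabledActions-sound N _ _ _)
                  in n , branching eq ts

    trees : ∀ {d as} → Acc (flip (_⟶_ N y)) d → All (Enabled N y d) as → ∃ (Trees d as)
    trees a [] = 0 , []
    trees {d} {z ∷ _} (acc rs) (e ∷ es) with allowed? (after z d) | trees (acc rs) es
    ... | yes f | n , ts = let m , t = tree (rs (move e)) in m + n , grow f t ts
    ... | no ¬f | n , ts = n , prune ¬f ts

  open Counting N y (λ _ → ⊤)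

  mutual
    tree-comp : ∀ {d n} → (∀ {d′} → Star (_⟶_ N y) d d′ → Allowed d′) → Tree d n → Comp d n
    tree-comp f (accepting e) = accepting tt (subst T (sym e) tt)
    tree-comp {d} f (branching e ts) = branching tt (subst T e) (enabledActions-unique N _ _ _)
      (enabledActions-complete N)
      ens (trees-branches f ens ts)
      where ens = enabledActions-sound N _ _ _

    trees-branches : ∀ {d as n} → (∀ {d′} → Star (_⟶_ N y) d d′ → Allowed d′) → All (Enabled N y d) as →
      Trees d as n → Branches d as n
    trees-branches f []       []            = []
    trees-branches f (e ∷ es) (grow _ t ts) = tree-comp (λ s → f (move e ◅ s)) t ∷ trees-branches f es ts
    trees-branches f (e ∷ es) (prune ¬f ts) = contradiction (f (move e ◅ ε)) ¬f

module SimCorrect {Σ : Set} (finiteΣ : Finite Σ) (M : OracleTM Σ) (N : NTM Σ) (p₀ D β : ℕ)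
  (codingM : Tracks.Coding (suc β) 12 (OracleTM.blank M))
  (codingN : Tracks.Coding (suc β) 12 (NTM.blank N))
  (w : List Σ) (B L : ℕ) (room : 3 + L ≤ B) (wide : 2 + length w ≤ (3 + β) ^ L) where

  open Program finiteΣ M N p₀ D β codingM codingN
  open Tracks (suc β) 12
  open RunCorrect finiteΣ M N p₀ D β codingM codingN w B L room wide

  module _ (σ : ConfigM) {sL sR sH : Track} (k₁ : Track)
    (sl₁ : SM.Stack sL (Tape.before (work σ))) (sr₁ : SM.Stack sR (Tape.after (work σ)))
    (sh : val sH ≡ head σ) (valid : head σ ≤ suc (length w))
    {c₁ : ConfigM} {y : List Σ} (asks : run fuel σ ≡ query c₁ y)
    (b : Bool) (c : Fin (2 + p₀)) where

    open Simulated N y L (base ^ L)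

    x : Saved
    x = state σ , Tape.current (work σ)

    full : Track → Track → Track → Track → Track → Track → Track → Track → Vec Track 12
    full nL nR nH cL cR h t k₂ = store sL sR sH nL nR nH k₁ cL cR h t k₂

    headN-left : ∀ s {v} → s ≢ ⊢ → headN left s v ≡ rightward simH decr 1F (λ _ → v)
    headN-left ⊢        ¬e = contradiction refl ¬e
    headN-left ⊣        ¬e = refl
    headN-left (char _) ¬e = refl

    headN-right : ∀ s {v} → s ≢ ⊣ → headN right s v ≡ rightward simH incr 1F (ifZero v Reject)
    headN-right ⊢        ¬e = refl
    headN-right ⊣        ¬e = contradiction refl ¬e
    headN-right (char _) ¬e = refl

    head-correct : ∀ {v₀ v i n nL nR nH cL cR h t k₂} dir j → ¬ T (final v₀) →
      instr v₀ (scan w i) ≡ headN dir (scan y j) v → val nH ≡ j → j ≤ suc (length y) →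
      (∀ {nH} → val nH ≡ moveInput y dir j → Reach v i (full nL nR nH cL cR h t k₂) n) →
      (¬ moveInput y dir j < base ^ L → n ≡ 0) →
      Reach v₀ i (full nL nR nH cL cR h t k₂) n
    head-correct stay j ¬f eq e b good bad = reach-jump ¬f eq (good e)
    head-correct left zero ¬f eq e b good bad = reach-jump ¬f eq (good e)
    head-correct {v₀} {v} {i} {n} {nL} {nR} {nH} {cL} {cR} {h} {t} {k₂} left (suc j) ¬f eq e b good bad =
      reach-rightward ¬f (trans eq (headN-left _ (scan≢⊢ y j))) (back (decrement nH))
      where
      back : ∀ {z} → Decremented nH z → Reach v i (full nL nR (proj₂ z) cL cR h t k₂) n
      back (borrow e′) = contradiction (trans (sym e) e′) λ ()
      back (ok e′)     = good (ℕ.suc-injective (trans (sym e′) e))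
    head-correct {v₀} {v} {i} {n} {nL} {nR} {nH} {cL} {cR} {h} {t} {k₂} right j ¬f eq e b good bad = decided (⊣? (scan y j))
      where
      forth : scan y j ≢ ⊣ → ∀ {z} → Incremented nH z →
              Reach (ifZero v Reject (proj₁ z)) i (full nL nR (proj₂ z) cL cR h t k₂) n
      forth ¬e (overflow {v′} e′) = subst (Reach Reject i (full nL nR v′ cL cR h t k₂))
        (sym (bad λ lt → ℕ.<-irrefl refl (subst (_< base ^ L) (trans (right-inside y j ¬e) (trans (cong suc (sym e)) e′)) lt))) reach-reject
      forth ¬e (ok e′) = good (trans e′ (trans (cong suc e) (sym (right-inside y j ¬e))))
      decided : Dec (scan y j ≡ ⊣) → Reach v₀ i (full nL nR nH cL cR h t k₂) n
      decided (yes es) = reach-jump ¬f (trans eq (cong (λ s → headN right s v) es)) (good (trans e (sym (right-at-end y j es b))))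
      decided (no ¬e)  = reach-rightward ¬f (trans eq (headN-right _ ¬e)) (forth ¬e (increment nH))

    module _ {m : ℕ} (end : ∀ {i nL nR nH cL cR h t k₂} → Reach (EndPhase b c x) i (full nL nR nH cL cR h t k₂) m) where

      -- The tracks of the current run of `M`, the scratch counter, `target`, `clock₂` and the input
      -- head are left arbitrary, because fetching a letter of the query destroys them.
      Loaded : Config N.Q N.Γ → ℕ → Set
      Loaded d n = ∀ {i nL nR nH cL cR h t k₂} →
        SN.Stack nL (Tape.before (work d)) → SN.Stack nR (Tape.after (work d)) → val nH ≡ head d →
        Reach (LoadN b c x (state d) (Tape.current (work d))) i (full nL nR nH cL cR h t k₂) n

      action-correct : ∀ d a {n i nL nR nH cL cR h t k₂} →
        SN.Stack nL (Tape.before (work d)) → SN.Stack nR (Tape.after (work d)) → val nH ≡ head d → head d ≤ suc (length y) →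
        (let d′ = perform N.blank y a d in Allowed d′ → Loaded d′ n) →
        (¬ Allowed (perform N.blank y a d) → n ≡ 0) →
        Reach (HeadN b c x a (scan y (head d))) i (full nL nR nH cL cR h t k₂) n
      action-correct d a@(action q g dir e) {n} {i} {nL} {nR} {cL = cL} {cR} {h} {t} {k₂} sl sr eh bd good bad =
        head-correct dir (head d) id refl eh bd moved (λ ¬lt → bad (¬lt ∘ proj₂))
        where
        moved : ∀ {nH} → val nH ≡ moveInput y dir (head d) → Reach (PopN b c x a) i (full nL nR nH cL cR h t k₂) n
        moved {nH} eh′ = reach-tape-move {reject = Reject} id (λ _ → refl) codingN {l = simL} {r = simR} (λ ()) {vp = PushN′} {vt = LoadN′} e
          {g} {τ = full nL nR nH cL cR h t k₂} id (λ _ → id) refl (λ _ → refl) refl sl sr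
          (λ fits sl′ sr′ → good (fits , below) sl′ sr′ eh′)
          (λ ¬fits → bad (¬fits ∘ proj₁))
          where
          below = subst (_< base ^ L) eh′ (val< nH)
          PushN′ LoadN′ : N.Γ → V
          PushN′ g′ = PushN b c x a g′
          LoadN′ g′ = LoadN b c x q g′

      mutual
        -- Each accepting leaf of the tree of `N` is continued by the `m` paths from `EndPhase`;
        -- hence the product.
        load-correct : ∀ {d n} → Tree d n → head d ≤ suc (length y) → Loaded d (n * m)
        load-correct {d} (accepting e) bd {i} {nL} {nR} {nH} {cL} {cR} {h} {t} {k₂} sl sr eh =
          subst (Reach (LoadN b c x (state d) (Tape.current (work d))) i (full nL nR nH cL cR h t k₂))
            (sym (ℕ.+-identityʳ m)) (reach-jump id (cong (λ z → loadN z (EndPhase b c x) (TestN b c x (state d) (Tape.current (work d)))) e) end)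
        load-correct {d} {n} (branching e ts) bd {i} {nL} {nR} {nH} {cL} {cR} {h} {t} {k₂} sl sr eh =
          reach-assigning {τ = full nL nR nH cL cR h t k₂} {ρ = testing} id (cong (λ z → loadN z (EndPhase b c x) (TestN b c x (state d) (Tape.current (work d)))) e)
            (reach-rightward {τ = full nL nR nH cL cR h nH k₂} {k = target} {f = decr} id refl (tested (decrement nH)))
          where
          stepped : ∀ {j i cL cR h t k₂} → j ≡ head d →
            Reach (StepN b c x (state d) (Tape.current (work d)) (scan y j)) i (full nL nR nH cL cR h t k₂) (n * m)
          stepped refl = reach-goto id refl (Unique.map⁺ (λ { refl → refl }) (enabledActions-unique N _ _ _))
            (step-correct ts sl sr eh bd)
          tested : ∀ {z} → Decremented nH z →
            Reach (ifZero (Reset (fetch b c (state d) (Tape.current (work d))) x) (StepN b c x (state d) (Tape.current (work d)) ⊢) (proj₁ z)) i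
              (full nL nR nH cL cR h (proj₂ z) k₂) (n * m)
          tested (borrow e) = stepped {0} (trans (sym e) eh)
          -- The rerun of `M` from the saved configuration is the run in `asks`, so it writes the
          -- same `y`.
          tested (ok {t′} e) = reset-correct _ _ _ _ _ _ _ (fetch b c (state d) (Tape.current (work d))) σ sl₁ sr₁ sh valid
            (subst (λ r → Outcome _ _ _ _ _ _ _ (fetch b c (state d) (Tape.current (work d))) x r (val t′) (n * m)) (sym asks)
              (stepped (trans (sym e) eh)))
        step-correct : ∀ {d as n i nL nR nH cL cR h t k₂} → Trees d as n →
          SN.Stack nL (Tape.before (work d)) → SN.Stack nR (Tape.after (work d)) → val nH ≡ head d → head d ≤ suc (length y) →
          Choices i (full nL nR nH cL cR h t k₂) (List.map (λ a → HeadN b c x a (scan y (head d))) as) (n * m)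
        step-correct [] sl sr eh bd = []
        step-correct {d} {i = i} (grow {a} {as} {m′} {n} f tr ts) sl sr eh bd = subst (Choices i _ _) (sym (ℕ.*-distribʳ-+ m m′ n))
          (action-correct d a sl sr eh bd (λ _ → load-correct tr (moveInput-≤ y (Action.inputDir a) bd)) (λ ¬f → contradiction f ¬f)
            ∷ step-correct ts sl sr eh bd)
        step-correct {d} (prune {a} ¬f ts) sl sr eh bd =
          action-correct d a sl sr eh bd (λ f → contradiction f ¬f) (λ _ → refl) ∷ step-correct ts sl sr eh bd

-- The number of accepting paths of the simulation

module RunSound {Σ : Set} (M : OracleTM Σ) (w : List Σ) (L : ℕ) where
  open OracleRuns M w L
  private
    module M = OracleTM M

  data _⟿[_]_ (c : ConfigM) : List Σ → ConfigM → Set where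
    []   : c ⟿[ [] ] c
    step : ∀ {a o y c′} → state c ≢ M.query →
           M.δ (state c) (scan w (head c)) (Tape.current (work c)) ≡ just (a , o) →
           perform M.blank w a c ⟿[ y ] c′ → c ⟿[ fromMaybe o ++ y ] c′

  ⟿-valid : ∀ {c y c′} → c ⟿[ y ] c′ → head c ≤ suc (length w) → head c′ ≤ suc (length w)
  ⟿-valid []                 b = b
  ⟿-valid (step {a} _ _ s) b = ⟿-valid s (moveInput-≤ w (Action.inputDir a) b)

  Halted : ConfigM → Result → Set
  Halted c dead        = ⊤
  Halted c accept      = ∃[ y ] ∃[ c′ ] c ⟿[ y ] c′ × T (M.accept (state c′))
  Halted c (query c′ y) = c ⟿[ y ] c′ × state c′ ≡ M.query

  mutual
    run-sound : ∀ k c → Halted c (run k c)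
    run-sound k c = examine-sound k c (decEq M.finiteQ (state c) M.query) _ refl

    examine-sound : ∀ k c d r → M.δ (state c) (scan w (head c)) (Tape.current (work c)) ≡ r → Halted c (examine k c d r)
    examine-sound k c (yes e) r eq = [] , e
    examine-sound k c (no ¬e) nothing eq with M.accept (state c) in eq′
    ... | true  = [] , c , [] , subst T (sym eq′) tt
    ... | false = tt
    examine-sound zero    c (no ¬e) (just _) eq = tt
    examine-sound (suc k) c (no ¬e) (just (a , o)) eq = proceed-sound k c a o ¬e eq (fits? L (work (perform M.blank w a c)))

    proceed-sound : ∀ k c a o → state c ≢ M.query → M.δ (state c) (scan w (head c)) (Tape.current (work c)) ≡ just (a , o) →
      ∀ d → Halted c (proceed k (perform M.blank w a c) o d)
    proceed-sound k c a o ¬e eq (no _)  = tt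
    proceed-sound k c a o ¬e eq (yes _) with run k (perform M.blank w a c) | run-sound k (perform M.blank w a c)
    ... | dead       | _               = tt
    ... | accept     | y , c′ , s , t = _ , c′ , step ¬e eq s , t
    ... | query c′ y | s , e           = step ¬e eq s , e

-- With f accepting paths of N, a query is answered yes with weight f and no
-- with weight (f + 1) ⋯ (f + (p − 1)); modulo p, just one of the two is nonzero.
weight : ℕ → ℕ → ℕ
weight n zero          = n
weight n (suc zero)    = n + 1
weight n (suc (suc k)) = (n + suc (suc k)) * weight n (suc k)

module Totals {Σ : Set} (M : OracleTM Σ) (w : List Σ) (L fuel : ℕ) (countN : List Σ → ℕ) (p₀ : ℕ) where
  open OracleRuns M w L
  private
    module M = OracleTM M

  resume : Bool → ConfigM → ConfigM
  resume b c = config (if b then M.yes else M.no) (head c) (work c)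

  mutual
    -- `k` is the value of `clock₁`, the number of queries still allowed. Both guesses are pursued
    -- whatever the true answer is; the final `+ 0` in `period` is the end of the list of the two
    -- alternatives.
    total : ℕ → ConfigM → ℕ
    total k σ = period k (run fuel σ)

    period : ℕ → Result → ℕ
    period k       dead        = 0
    period k       accept      = 1
    period zero    (query c y) = 0
    period (suc k) (query c y) = weight (countN y) 0 * total k (resume true c)
      + (weight (countN y) (suc p₀) * total k (resume false c) + 0)

module MainCorrect {Σ : Set} (finiteΣ : Finite Σ) (M : OracleTM Σ) (N : NTM Σ) (p₀ D β : ℕ)
  (codingM : Tracks.Coding (suc β) 12 (OracleTM.blank M))
  (codingN : Tracks.Coding (suc β) 12 (NTM.blank N))
  (w : List Σ) (B L : ℕ) (room : 3 + L ≤ B) (wide : 2 + length w ≤ (3 + β) ^ L)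
  (halts : ∀ y → Halts N y) where

  open Program finiteΣ M N p₀ D β codingM codingN
  open Tracks (suc β) 12
  open RunCorrect finiteΣ M N p₀ D β codingM codingN w B L room wide
  open SimCorrect finiteΣ M N p₀ D β codingM codingN w B L room wide
  open RunSound M w L

  countN : List Σ → ℕ
  countN y = proj₁ (Simulated.tree N y L (base ^ L) (halts y))

  open Totals M w L fuel countN p₀ public

  choices-map : ∀ {I : Set} {i τ n} (f : I → V) → (∀ j → Reach (f j) i τ n) → ∀ js → Choices i τ (List.map f js) (length js * n)
  choices-map f t []       = []
  choices-map f t (j ∷ js) = t j ∷ choices-map f t js

  mutual
    measure-correct : ∀ {g q sL sR nL nR nH k₁ n cL cR h t k₂} i j {sH} → val sH ≡ j → i + j ≤ suc (length w) →
      (∀ {sH} → val sH ≡ i + j → Reach (Reset probe (q , g)) 0 (store sL sR sH nL nR nH k₁ cL cR h t k₂) n) →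
      Reach (Measure (q , g)) i (store sL sR sH nL nR nH k₁ cL cR h t k₂) n
    measure-correct zero j e b k = reach-jump id refl (k e)
    measure-correct {g} {q} (suc i) j {sH} e b k = reach-jump id (more _ (scan≢⊢ w i))
      (reach-rightward id refl (measured i j (increment sH) e b k))
      where
      more : ∀ s → s ≢ ⊢ → instr (Measure (q , g)) s ≡ goto stay (MeasureInc (q , g) ∷ [])
      more ⊢        ¬e = contradiction refl ¬e
      more ⊣        ¬e = refl
      more (char _) ¬e = refl

    measured : ∀ {g q sL sR nL nR nH k₁ n cL cR h t k₂} i j {sH z} → Incremented sH z → val sH ≡ j → suc i + j ≤ suc (length w) →
      (∀ {sH} → val sH ≡ suc i + j → Reach (Reset probe (q , g)) 0 (store sL sR sH nL nR nH k₁ cL cR h t k₂) n) →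
      Reach (ifZero (MeasureNext (q , g)) Reject (proj₁ z)) (suc i) (store sL sR (proj₂ z) nL nR nH k₁ cL cR h t k₂) n
    -- Excluded by `wide`: all head positions, up to `suc (length w)`, are below the capacity of a
    -- counter.
    measured i j (overflow e′) e b k = contradiction wide (ℕ.<⇒≱ (ℕ.≤-trans (s≤s (ℕ.≤-reflexive (trans (sym e′) (cong suc e))))
      (ℕ.≤-trans (s≤s (s≤s (ℕ.m≤n+m j i))) (ℕ.≤-trans (s≤s b) ℕ.≤-refl))))
    measured i j (ok e′) e b k = reach-jump id refl (measure-correct i (suc j) (trans e′ (cong suc e)) (subst (_≤ suc (length w)) (sym (ℕ.+-suc i j)) b)
      λ e″ → k (trans e″ (ℕ.+-suc i j)))

  module _ (σ : ConfigM) {sL sR sH : Track} (k₁ : Track)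
    (sl₁ : SM.Stack sL (Tape.before (work σ))) (sr₁ : SM.Stack sR (Tape.after (work σ)))
    (sh : val sH ≡ head σ) (valid : head σ ≤ suc (length w))
    {c₁ : ConfigM} {y : List Σ} (asks : run fuel σ ≡ query c₁ y)
    (b : Bool) where

    private
      x₁ : Saved
      x₁ = state σ , Tape.current (work σ)

      After : V → ℕ → Set
      After v n = ∀ {i nL nR nH cL cR h t k₂} → Reach v i (store sL sR sH nL nR nH k₁ cL cR h t k₂) n

    phase-step : ∀ c {m} → After (EndPhase b c x₁) m → After (Phase b c x₁) ((countN y + toℕ c) * m)
    phase-step c {m} end {i} {nL} {nR} {nH} {cL} {cR} {h} {t} {k₂} =
      subst (Reach (Phase b c x₁) i (store sL sR sH nL nR nH k₁ cL cR h t k₂)) total-weight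
        (reach-goto id refl (All.map⁺ (All.universal (λ _ ()) _) ∷ Unique.map⁺ (λ { refl → refl }) (Unique.allFin⁺ (toℕ c)))
          (simulate ∷ choices-map (λ i → Free b c i x₁) (λ _ → reach-jump id refl end) (List.allFin (toℕ c))))
      where
      simulate : Reach (StartN b c x₁) i (store sL sR sH nL nR nH k₁ cL cR h t k₂) (countN y * m)
      simulate = reach-assigning {τ = store sL sR sH nL nR nH k₁ cL cR h t k₂} {ρ = starting} id refl
        (load-correct σ k₁ sl₁ sr₁ sh valid asks b c end (proj₂ (Simulated.tree N y L (base ^ L) (halts y))) z≤n
          SN.empty SN.empty (val-zero L))
      total-weight : countN y * m + length (List.allFin (toℕ c)) * m ≡ (countN y + toℕ c) * m
      total-weight = trans (sym (ℕ.*-distribʳ-+ m (countN y) _)) (cong (λ k → (countN y + k) * m) (List.length-tabulate {n = toℕ c} id))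

    phase-correct : ∀ {m} → After (Reset (advance b) x₁) m → ∀ k c → toℕ c ≡ k → After (Phase b c x₁) (weight (countN y) k * m)
    phase-correct {m} end zero zero refl {i} {nL} {nR} {nH} {cL} {cR} {h} {t} {k₂} =
      subst (λ n → Reach (Phase b 0F x₁) i (store sL sR sH nL nR nH k₁ cL cR h t k₂) (n * m)) (ℕ.+-identityʳ (countN y))
        (phase-step 0F (reach-jump id refl end))
    phase-correct end (suc zero) (suc zero) refl = phase-step 1F (reach-jump id refl end)
    phase-correct {m} end (suc (suc k)) (suc (suc c)) refl {i} {nL} {nR} {nH} {cL} {cR} {h} {t} {k₂} =
      subst (Reach (Phase b (suc (suc c)) x₁) i (store sL sR sH nL nR nH k₁ cL cR h t k₂))
        (sym (ℕ.*-assoc (countN y + suc (suc (toℕ c))) (weight (countN y) (suc (toℕ c))) m))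
        (phase-step (suc (suc c)) (reach-jump id refl (phase-correct end (suc (toℕ c)) (Fin.inject₁ (suc c)) (cong suc (Fin.toℕ-inject₁ c)))))

  -- By induction on `clock₁`. The probe, every fetch of a letter and the final run past the query
  -- all start from `σ`, and so all have the one result `run fuel σ`.
  main-correct : ∀ k σ {k₁ sL sR sH i nL nR nH cL cR h t k₂} → val k₁ ≡ k →
    SM.Stack sL (Tape.before (work σ)) → SM.Stack sR (Tape.after (work σ)) →
    val sH ≡ head σ → head σ ≤ suc (length w) →
    Reach (Reset probe (state σ , Tape.current (work σ))) i (store sL sR sH nL nR nH k₁ cL cR h t k₂) (total k σ)
  main-correct k σ {k₁} {sL} {sR} {sH} {nL = nL} {nR} {nH} ek sl sr sh valid =
    reset-correct sL sR sH nL nR nH k₁ probe σ sl sr sh valid (ended k ek (run fuel σ) refl)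
    where
    x₁ : Saved
    x₁ = state σ , Tape.current (work σ)

    resumed : ∀ k {k₁ c y} → val k₁ ≡ k → run fuel σ ≡ query c y → ∀ b {i nL nR nH cL cR h t k₂} →
      Reach (Reset (advance b) x₁) i (store sL sR sH nL nR nH k₁ cL cR h t k₂) (total k (resume b c))
    resumed k {k₁} {c} {y} ek asks b {nL = nL} {nR} {nH} = reset-correct sL sR sH nL nR nH k₁ (advance b) σ sl sr sh valid
      (subst (λ r → Outcome sL sR sH nL nR nH k₁ (advance b) x₁ r _ _) (sym asks) saved)
      where
      valid′ : head c ≤ suc (length w)
      valid′ = ⟿-valid (proj₁ (subst (Halted σ) asks (run-sound fuel σ))) valid
      saved : ∀ {cL cR h t k₂} → SM.Stack cL (Tape.before (work c)) → SM.Stack cR (Tape.after (work c)) →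
        Reach (Save (answer b , Tape.current (work c))) (head c) (store sL sR sH nL nR nH k₁ cL cR h t k₂) (total k (resume b c))
      saved {cL} {cR} {h} {t} {k₂} sl′ sr′ = reach-assigning {τ = store sL sR sH nL nR nH k₁ cL cR h t k₂} {ρ = saving} id refl
        (measure-correct {sL = cL} {sR = cR} {nL = nL} {nR} {nH} {k₁} {cL = cL} {cR} {h} {t} {k₂} (head c) 0 (val-zero L) (subst (_≤ suc (length w)) (sym (ℕ.+-identityʳ _)) valid′)
          λ e → main-correct k (resume b c) ek sl′ sr′ (trans e (ℕ.+-identityʳ _)) valid′)

    ended : ∀ k → val k₁ ≡ k → ∀ r → run fuel σ ≡ r → ∀ {t} → Outcome sL sR sH nL nR nH k₁ probe x₁ r t (period k r)
    ended k ek dead   eq = refl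
    ended k ek accept eq = refl
    ended k ek (query c y) eq = reach-rightward id refl (asked k ek (decrement k₁))
      where
      asked : ∀ k → val k₁ ≡ k → ∀ {z i cL cR h t k₂} → Decremented k₁ z →
        Reach (ifZero (Guess x₁) Reject (proj₁ z)) i (store sL sR sH nL nR nH (proj₂ z) cL cR h t k₂) (period k (query c y))
      asked zero ek (borrow _) = reach-reject
      asked zero ek (ok e) = contradiction (trans (sym ek) e) λ ()
      asked (suc k) ek (borrow e) = contradiction (trans (sym ek) e) λ ()
      asked (suc k) ek (ok {k₁′} e) = reach-goto id refl (((λ ()) ∷ []) ∷ [] ∷ [])
        (phase-correct σ k₁′ sl sr sh valid eq true (resumed k ek′ eq true) 0 0F refl
          ∷ phase-correct σ k₁′ sl sr sh valid eq false (resumed k ek′ eq false) (suc p₀) (Fin.fromℕ (suc p₀)) (Fin.toℕ-fromℕ (suc p₀))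
          ∷ [])
        where ek′ = ℕ.suc-injective (trans (sym e) ek)

-- Marking off a logarithmic number of cells

binarySucc : List Bool → List Bool
binarySucc []           = true ∷ []
binarySucc (false ∷ bs) = true ∷ bs
binarySucc (true ∷ bs)  = false ∷ binarySucc bs

-- Least significant digit first.
binary : ℕ → List Bool
binary zero    = []
binary (suc m) = binarySucc (binary m)

module InitCorrect {Σ : Set} (finiteΣ : Finite Σ) (M : OracleTM Σ) (N : NTM Σ) (p₀ D β : ℕ)
  (codingM : Tracks.Coding (suc β) 12 (OracleTM.blank M))
  (codingN : Tracks.Coding (suc β) 12 (NTM.blank N)) where

  open Program finiteΣ M N p₀ D β codingM codingN
  open Tracks (suc β) 12
  open TrackRun {Σ = Σ} finiteV Count final instr using (sweeper; module Rules)

  Cell : Set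
  Cell = Vec A 12

  fillers : ℕ → List Cell
  fillers d = List.replicate d (countCell 2F)

  digit : Bool → A
  digit b = if b then 1F else 0F

  block : Bool → List Cell
  block b = countCell (digit b) ∷ fillers D

  blocks : List Bool → List Cell
  blocks = List.concatMap block

  private
    f = onTrack target incr₂

  pass-done : ∀ {Y : Set} (g : A → Y → A × Y) → (∀ y → g 0F y ≡ (0F , y)) → ∀ u → passʳ g 0F u ≡ (0F , u)
  pass-done g e []      = refl
  pass-done g e (y ∷ u) rewrite e y | pass-done g e u = refl

  pass-fillers : ∀ d u → passʳ f 1F (fillers d ++ u) ≡ (proj₁ (passʳ f 1F u) , fillers d ++ proj₂ (passʳ f 1F u))
  pass-fillers zero    u = refl
  pass-fillers (suc d) u rewrite pass-fillers d u = refl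

  -- After a carry, `u` lacks only the last block, which the turn and the `Fill` states append.
  data Counted (bs : List Bool) : A × List Cell → Set where
    settled : Counted bs (0F , blocks (binarySucc bs))
    carried : ∀ {u} → u ++ block true ≡ blocks (binarySucc bs) → Counted bs (1F , u)

  counted : ∀ bs → Counted bs (passʳ f 1F (blocks bs))
  counted [] = carried (sym (List.++-identityʳ (block true)))
  counted (false ∷ bs) rewrite pass-done f (λ c → cong (0F ,_) (Vec.[]≔-lookup c target)) (fillers D ++ blocks bs) = settled
  counted (true ∷ bs) rewrite pass-fillers D (blocks bs) with passʳ f 1F (blocks bs) | counted bs
  ... | _ | settled   = settled
  ... | _ | carried {u} e = carried (cong (countCell 0F ∷_) (trans (List.++-assoc (fillers D) u (block true)) (cong (fillers D ++_) e)))

  fromCells : ∀ {K} (u : List (Vec A K)) → Vec (Vec A (length u)) K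
  fromCells []      = replicate _ []
  fromCells (c ∷ u) = Vec.zipWith _∷_ c (fromCells u)

  cells-fromCells : ∀ u → cells (fromCells u) ≡ u
  cells-fromCells []      = refl
  cells-fromCells (c ∷ u) = cong₂ _∷_ (heads c (fromCells u)) (trans (cong cells (tails c (fromCells u))) (cells-fromCells u))
    where
    heads : ∀ {L K} (c : Vec A K) (τ : Vec (Vec A L) K) → Vec.map Vec.head (Vec.zipWith _∷_ c τ) ≡ c
    heads []      []      = refl
    heads (a ∷ c) (v ∷ τ) = cong (a ∷_) (heads c τ)
    tails : ∀ {L K} (c : Vec A K) (τ : Vec (Vec A L) K) → Vec.map Vec.tail (Vec.zipWith _∷_ c τ) ≡ τ
    tails []      []      = refl
    tails (a ∷ c) (v ∷ τ) = cong (v ∷_) (tails c τ)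

  length-blocks : ∀ bs → length (blocks bs) ≡ length bs * suc D
  length-blocks []       = refl
  length-blocks (b ∷ bs) = cong suc (trans (List.length-++ (fillers D)) (cong₂ _+_ (List.length-replicate D) (length-blocks bs)))

  length-binarySucc : ∀ bs → length bs ≤ length (binarySucc bs)
  length-binarySucc []           = z≤n
  length-binarySucc (false ∷ bs) = ℕ.≤-refl
  length-binarySucc (true ∷ bs)  = s≤s (length-binarySucc bs)

  size : ℕ → ℕ
  size m = length (blocks (binary m))

  size-mono : ∀ {m n} → m ≤ n → size m ≤ size n
  size-mono {m} {n} le = subst (λ n → size m ≤ size n) (ℕ.m∸n+n≡m le) (up (n ∸ m))
    where
    up : ∀ k → size m ≤ size (k + m)
    up zero    = ℕ.≤-refl
    up (suc k) = ℕ.≤-trans (up k) (ℕ.≤-trans (ℕ.≤-reflexive (length-blocks (binary (k + m))))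
      (ℕ.≤-trans (ℕ.*-monoˡ-≤ (suc D) (length-binarySucc (binary (k + m)))) (ℕ.≤-reflexive (sym (length-blocks (binary (suc k + m)))))))

  module Count (w : List Σ) (B : ℕ) where
    open Sweeping.Run sweeper w B

    fill-correct : ∀ {i n} k (d : Fin (suc D)) u → toℕ d ≡ k → 3 + length (u ++ fillers k) ≤ B →
      At Onward i (u ++ fillers k) n → At (Fill d) i u n
    fill-correct {i} {n} zero zero u e b t ev = subst (Comp _) (ℕ.+-identityʳ n)
      (at-goto (ℕ.≤-trans (ℕ.n≤1+n _) (subst (λ u → 3 + length u ≤ B) (List.++-identityʳ u) b)) id refl ([] ∷ [])
        (subst (λ u → At Onward i u n) (List.++-identityʳ u) t ∷ []) ev)
    fill-correct {i} {n} (suc k) (suc d) u refl b t = at-sweep refl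
      (ℕ.≤-trans (s≤s (s≤s (s≤s (ℕ.≤-trans (ℕ.m≤m+n _ _) (ℕ.≤-reflexive (sym (List.length-++ u))))))) b) id
      (subst (λ u′ → At (Fill (Fin.inject₁ d)) i (u′ ++ countCell 2F ∷ []) n) (sym passes)
        (fill-correct (toℕ d) (Fin.inject₁ d) (u ++ countCell 2F ∷ []) (Fin.toℕ-inject₁ d)
          (subst (λ u → 3 + length u ≤ B) (sym assoc) b) (subst (λ u → At Onward i u n) (sym assoc) t)))
      where
      passes : proj₂ (passˡ _,_ (proj₁ (passʳ _,_ 0F u)) (proj₂ (passʳ _,_ 0F u))) ≡ u
      passes = trans (cong (λ (r , u) → proj₂ (passˡ _,_ r u)) (passʳ-id 0F u)) (cong proj₂ (passˡ-id 0F u))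
      assoc : (u ++ countCell 2F ∷ []) ++ fillers (toℕ d) ≡ u ++ fillers (suc (toℕ d))
      assoc = List.++-assoc u _ _

    count-correct : ∀ {i n} bs → 3 + length (blocks (binarySucc bs)) ≤ B →
      At Onward i (blocks (binarySucc bs)) n → At Count i (blocks bs) n
    count-correct {i} {n} bs b t = at-sweep refl
      (ℕ.≤-trans (s≤s (s≤s (s≤s (ℕ.≤-trans (ℕ.≤-reflexive (length-blocks bs)) (ℕ.≤-trans (ℕ.*-monoˡ-≤ (suc D) (length-binarySucc bs))
        (ℕ.≤-reflexive (sym (length-blocks (binarySucc bs))))))))) b) id (after (counted bs))
      where
      after : ∀ {z} → Counted bs z →
        (let m , r = overflowing (proj₁ z) ; r′ , u = passˡ _,_ r (proj₂ z) in
         At (ifZero Onward (Fill (Fin.fromℕ D)) r′) i (u ++ fromMaybe m) n)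
      after settled = subst (λ z → At (ifZero Onward (Fill (Fin.fromℕ D)) (proj₁ z)) i (proj₂ z ++ []) n)
        (sym (passˡ-id 0F (blocks (binarySucc bs)))) (subst (λ u → At Onward i u n) (sym (List.++-identityʳ _)) t)
      after (carried {u} e) = subst (λ z → At (ifZero Onward (Fill (Fin.fromℕ D)) (proj₁ z)) i (proj₂ z ++ countCell 1F ∷ []) n)
        (sym (passˡ-id 1F u))
        (fill-correct D (Fin.fromℕ D) (u ++ countCell 1F ∷ []) (Fin.toℕ-fromℕ D)
          (subst (λ u → 3 + length u ≤ B) (sym e′) b) (subst (λ u → At Onward i u n) (sym e′) t))
        where
        e′ : (u ++ countCell 1F ∷ []) ++ fillers D ≡ blocks (binarySucc bs)
        e′ = trans (List.++-assoc u _ _) e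

    -- Including the endmarkers there are `2 + length w` head positions, with one increment at each
    -- of them. `size-mono` bounds the intermediate lists by the last one.
    all-counted : ∀ {n} r i → i + r ≡ suc (length w) → 3 + size (2 + length w) ≤ B →
      At Prepare (suc (length w)) (blocks (binary (2 + length w))) n → At Count i (blocks (binary i)) n
    all-counted {n} r i e b t = count-correct (binary i) b′ (onward r e)
      where
      b′ : 3 + size (suc i) ≤ B
      b′ = ℕ.≤-trans (s≤s (s≤s (s≤s (size-mono (s≤s (subst (i ≤_) e (ℕ.m≤m+n i r))))))) b
      jump : ∀ {i d v} {u : List Cell} → 3 + length u ≤ B → instr Onward (scan w i) ≡ goto d (v ∷ []) →
             At v (moveInput w d i) u n → At Onward i u n
      jump {i} {d} {v} {u} b eq t ev = subst (Comp _) (ℕ.+-identityʳ n) (at-goto (ℕ.≤-trans (ℕ.n≤1+n _) b) id eq ([] ∷ []) (t ∷ []) ev)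
      further : ∀ s → s ≢ ⊣ → instr Onward s ≡ goto right (Count ∷ [])
      further ⊢        ¬e = refl
      further ⊣        ¬e = contradiction refl ¬e
      further (char _) ¬e = refl
      onward : ∀ r → i + r ≡ suc (length w) → At Onward i (blocks (binary (suc i))) n
      onward zero e = jump b′ (cong (instr Onward) (trans (cong (scan w) e′) (trans (scan-look w (length w)) (look-≥ w (length w) ℕ.≤-refl))))
        (subst (λ i → At Prepare i (blocks (binary (suc i))) n) (sym e′) t)
        where e′ = trans (sym (ℕ.+-identityʳ i)) e
      onward (suc r) e = jump b′ (further (scan w i) inside)
        (subst (λ j → At Count j (blocks (binary (suc i))) n) (sym (right-inside w i inside))
          (all-counted r (suc i) (trans (sym (ℕ.+-suc i r)) e) b t))
        where
        inside : scan w i ≢ ⊣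
        inside = scan≢⊣ w i (ℕ.≤-pred (subst (suc i ≤_) (trans (sym (ℕ.+-suc i r)) e) (ℕ.m≤m+n (suc i) r)))

  machine-correct : (halts : ∀ y → Halts N y) (w : List Σ) →
    let L = size (2 + length w) ; B = 3 + L in
    (wide : 2 + length w ≤ (3 + β) ^ L) →
    Counting.Comp machine w (λ c → space c ≤ B) (initial (NTM.start machine) (NTM.blank machine))
      (Totals.total M w L (val (replicate L top)) (λ y → proj₁ (Simulated.tree N y L ((3 + β) ^ L) (halts y))) p₀
        (val (replicate L top)) (initial M.start M.blank))
  -- `false`: nothing to the right of the head has been visited yet, and the numeral of 0 is the
  -- empty list of cells.
  machine-correct halts w wide = Count.all-counted w B (suc (length w)) 0 refl ℕ.≤-refl prepared false
    where
    u = blocks (binary (2 + length w))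
    L = length u
    B = 3 + L
    open Rules w B {L} ℕ.≤-refl using (Reach; reach; reach-assigning)
    open MainCorrect finiteΣ M N p₀ D β codingM codingN w B L ℕ.≤-refl wide halts using (total; main-correct)
    open Sweeping.Run sweeper w B using (At)
    σ₀ : Config M.Q M.Γ
    σ₀ = initial M.start M.blank
    k : ℕ
    k = val (replicate L top)
    -- The digits and fillers of the count may be read as arbitrary tracks, since `preparing`
    -- overwrites all of them.
    started : Reach Prepare (suc (length w)) (fromCells u) (total k σ₀)
    started = reach-assigning {τ = fromCells u} {ρ = preparing} id refl
      (main-correct k σ₀ refl SM.empty SM.empty (val-zero L) z≤n)
    unwrap : ∀ {v i τ n} → Reach v i τ n → At v i (cells τ) n
    unwrap (reach t) = t
    prepared : At Prepare (suc (length w)) u (total k σ₀)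
    prepared = subst (λ u → At Prepare (suc (length w)) u (total k σ₀)) (cells-fromCells u) (unwrap started)

-- Weights modulo p, and clocks

-- As `p` divides `n`, a factor `n + j` is congruent to `j` with 0 < j < p, and Euclid's lemma
-- passes from the factors to the product.
weight-nonzero : ∀ {p n} → Prime p → p ∣ n → ∀ k → suc k < p → p ∤ weight n (suc k)
weight-nonzero {p} pr p∣n zero    lt d = >⇒∤ lt (∣m+n∣m⇒∣n d p∣n)
weight-nonzero {p} {n} pr p∣n (suc k) lt d = [ (λ d → >⇒∤ lt (∣m+n∣m⇒∣n d p∣n)) , weight-nonzero pr p∣n k (ℕ.<-trans (ℕ.n<1+n _) lt) ]′
  (euclidsLemma (n + suc (suc k)) (weight n (suc k)) pr d)

factor∣weight : ∀ n k {j} → 1 ≤ j → j ≤ suc k → n + j ∣ weight n (suc k)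
factor∣weight n zero    (s≤s z≤n) (s≤s z≤n) = divides 1 (sym (ℕ.*-identityˡ (n + 1)))
factor∣weight n (suc k) {j} l u with j ℕ.≟ suc (suc k)
... | yes refl = ∣m⇒∣m*n (weight n (suc k)) (divides 1 (sym (ℕ.*-identityˡ (n + j))))
... | no ¬e    = ∣n⇒∣m*n (n + suc (suc k)) (factor∣weight n k l (ℕ.≤-pred (ℕ.≤∧≢⇒< u ¬e)))

-- The factor `n + j` with j = p - (n mod p) is a multiple of p; the remainder is positive because p
-- does not divide n, so j lies between 1 and p - 1.
weight-zero : ∀ p₀ n → 2 + p₀ ∤ n → 2 + p₀ ∣ weight n (suc p₀)
weight-zero p₀ n ¬d = ∣-trans (divides (suc (n / p)) complement) (factor∣weight n p₀ (ℕ.m<n⇒0<n∸m (m%n<n n p)) small)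
  where
  p = 2 + p₀
  r = n % p
  small : p ∸ r ≤ suc p₀
  small = ℕ.≤-pred (ℕ.≤-<-trans ℕ.≤-refl (ℕ.∸-monoʳ-< (ℕ.n≢0⇒n>0 (¬d ∘ m%n≡0⇒n∣m n p)) (ℕ.<⇒≤ (m%n<n n p))))
  complement : n + (p ∸ r) ≡ suc (n / p) * p
  complement = begin
    n + (p ∸ r)                   ≡⟨ cong (_+ (p ∸ r)) (trans (m≡m%n+[m/n]*n n p) (ℕ.+-comm r (n / p * p))) ⟩
    n / p * p + r + (p ∸ r)       ≡⟨ ℕ.+-assoc (n / p * p) r (p ∸ r) ⟩
    n / p * p + (r + (p ∸ r))     ≡⟨ cong (n / p * p +_) (ℕ.m+[n∸m]≡n (ℕ.<⇒≤ (m%n<n n p))) ⟩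
    n / p * p + p                 ≡⟨ ℕ.+-comm (n / p * p) p ⟩
    suc (n / p) * p               ∎
    where open ≡-Reasoning

-- In a deterministic system the distance to the end is a function of the
-- position, so a terminating run visits every position at most once.
module Pigeonhole {X : Set} (R : X → X → Set) (End Good : X → Set)
  (deterministic : ∀ {x y z} → R x y → R x z → y ≡ z) (end : ∀ {x y} → End x → ¬ R x y)
  {T : ℕ} (code : X → Fin T) (code-injective : ∀ {x y} → Good x → Good y → code x ≡ code y → x ≡ y) where

  data Dist (x : X) : ℕ → Set where
    stop : Good x → End x → Dist x 0
    next : ∀ {y n} → Good x → R x y → Dist y n → Dist x (suc n)

  dist-good : ∀ {x n} → Dist x n → Good x
  dist-good (stop g _)   = g
  dist-good (next g _ _) = g

  dist-unique : ∀ {x m n} → Dist x m → Dist x n → m ≡ n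
  dist-unique (stop _ _)   (stop _ _)    = refl
  dist-unique (stop _ e)   (next _ r _)  = contradiction r (end e)
  dist-unique (next _ r _) (stop _ e)    = contradiction r (end e)
  dist-unique (next _ r d) (next _ r′ d′) with refl ← deterministic r r′ = cong suc (dist-unique d d′)

  visited-at : ∀ {x n} → Dist x n → ∀ i → i ≤ n → ∃ λ y → Dist y i
  visited-at {x} {n} d i i≤n with ℕ.m≤n⇒m<n∨m≡n i≤n
  ... | inj₂ refl = x , d
  visited-at (next _ _ d) i _ | inj₁ i<n = visited-at d i (ℕ.≤-pred i<n)

  dist-bound : ∀ {x n} → Dist x n → n < T
  dist-bound {x} {n} d = Fin.injective⇒≤ {f = λ i → code (proj₁ (at i))} injective
    where
    at : (i : Fin (suc n)) → ∃ λ y → Dist y (toℕ i)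
    at i = visited-at d (toℕ i) (ℕ.≤-pred (Fin.toℕ<n i))
    injective : ∀ {i j} → code (proj₁ (at i)) ≡ code (proj₁ (at j)) → i ≡ j
    injective {i} {j} e = Fin.toℕ-injective (dist-unique (proj₂ (at i))
      (subst (λ y → Dist y (toℕ j)) (sym (code-injective (dist-good (proj₂ (at i))) (dist-good (proj₂ (at j))) e)) (proj₂ (at j))))

-- The true run of the oracle machine and the path count modulo p

padded : {Γ : Set} (L : ℕ) → List Γ → Vec (Maybe Γ) L
padded zero    l       = []
padded (suc L) []      = nothing ∷ padded L []
padded (suc L) (x ∷ l) = just x ∷ padded L l

padded-injective : {Γ : Set} (L : ℕ) {l m : List Γ} → length l ≤ L → length m ≤ L → padded L l ≡ padded L m → l ≡ m
padded-injective zero    {[]}    {[]}    a b e = refl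
padded-injective (suc L) {[]}    {[]}    a b e = refl
padded-injective (suc L) {[]}    {_ ∷ _} a b ()
padded-injective (suc L) {_ ∷ _} {[]}    a b ()
padded-injective (suc L) {x ∷ l} {y ∷ m} (s≤s a) (s≤s b) e with refl , e′ ← Vec.∷-injective e =
  cong (x ∷_) (padded-injective L a b e′)

module OracleMath {Σ : Set} (M : OracleTM Σ) (A : Language Σ) (w : List Σ) (L : ℕ) where
  open OracleRuns M w L
  open RunSound M w L
  private
    module M = OracleTM M

  Good : ConfigM → Set
  Good c = Fits L (work c) × head c ≤ suc (length w)

  finiteCode : Finite (M.Q × Fin (2 + length w) × M.Γ × Vec (Maybe M.Γ) L × Vec (Maybe M.Γ) L)
  finiteCode = finite-× M.finiteQ (finite-× (finite-Fin _) (finite-× M.finiteΓ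
    (finite-× (finite-Vec (finite-Maybe M.finiteΓ) L) (finite-Vec (finite-Maybe M.finiteΓ) L))))

  configurations : ℕ
  configurations = proj₁ finiteCode

  encode : ConfigM → M.Q × Fin (2 + length w) × M.Γ × Vec (Maybe M.Γ) L × Vec (Maybe M.Γ) L
  -- Capping the head position makes the code total; it changes nothing on `Good` configurations.
  encode (config q i (tape l g r)) = q , Fin.fromℕ< (s≤s (ℕ.m⊓n≤n i (suc (length w)))) , g , padded L l , padded L r

  encode-injective : ∀ {c d} → Good c → Good d → encode c ≡ encode d → c ≡ d
  encode-injective {config q i (tape l g r)} {config q′ i′ (tape l′ g′ r′)} ((fl , fr) , b) ((fl′ , fr′) , b′) e = same
    (cong proj₁ e)
    (trans (sym (ℕ.m≤n⇒m⊓n≡m b)) (trans (Fin.fromℕ<-injective _ _ _ _ (cong (proj₁ ∘ proj₂) e)) (ℕ.m≤n⇒m⊓n≡m b′)))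
    (cong (proj₁ ∘ proj₂ ∘ proj₂) e)
    (padded-injective L fl fl′ (cong (proj₁ ∘ proj₂ ∘ proj₂ ∘ proj₂) e))
    (padded-injective L fr fr′ (cong (proj₂ ∘ proj₂ ∘ proj₂ ∘ proj₂) e))
    where
    same : q ≡ q′ → i ≡ i′ → g ≡ g′ → l ≡ l′ → r ≡ r′ → config q i (tape l g r) ≡ config q′ i′ (tape l′ g′ r′)
    same refl refl refl refl refl = refl

  code : ConfigM → Fin configurations
  code c = Inverse.to (proj₂ finiteCode) (encode c)

  code-injective : ∀ {c d} → Good c → Good d → code c ≡ code d → c ≡ d
  code-injective g g′ e = encode-injective g g′ (trans (sym (Inverse.strictlyInverseʳ (proj₂ finiteCode) _))
    (trans (cong (Inverse.from (proj₂ finiteCode)) e) (Inverse.strictlyInverseʳ (proj₂ finiteCode) _)))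

module OracleTotals {Σ : Set} (M : OracleTM Σ) (A : Language Σ) (w : List Σ) (L fuel : ℕ)
  (countN : List Σ → ℕ) (p₀ : ℕ) (pr : Prime (2 + p₀))
  (oracle : ∀ {c y} → Reachable M A w (c , y) → state c ≡ OracleTM.query M → y ∈ᴸ A ⇔ (2 + p₀) ∤ countN y)
  (fitting : ∀ {c y} → Reachable M A w (c , y) → Fits L (work c))
  (enough : OracleMath.configurations M A w L ≤ suc fuel) where
  open OracleRuns M w L
  open RunSound M w L
  open OracleMath M A w L
  open Totals M w L fuel countN p₀
  private
    module M = OracleTM M
    p = 2 + p₀

  σ₀ : ConfigM
  σ₀ = initial M.start M.blank

  Answered : Bool → List Σ → Set
  Answered true  y = y ∈ᴸ A
  Answered false y = y ∉ᴸ A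

  Reached : ConfigM → List Σ → Set
  Reached c y = Reachable M A w (c , y)

  ⟿-reached : ∀ {c y z c′} → c ⟿[ z ] c′ → Reached c y → Reached c′ (y ++ z)
  ⟿-reached {y = y} [] r = subst (Reached _) (sym (List.++-identityʳ y)) r
  ⟿-reached {y = y} (step {o = o} {z} ¬q e s) r = subst (Reached _) (List.++-assoc y (fromMaybe o) z)
    (⟿-reached s (r ◅◅ (move ¬q e ◅ ε)))

  asked : ∀ b {c y} → state c ≡ M.query → Answered b y → Reached c y → Reached (resume b c) []
  asked true  {config _ i t} refl a r = r ◅◅ (ask-yes a ◅ ε)
  asked false {config _ i t} refl a r = r ◅◅ (ask-no a ◅ ε)

  reached-good : ∀ {c y} → Reached c y → Good c
  reached-good r = fitting r , stay-valid r z≤n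
    where
    stay-valid : ∀ {c d} → Star (_⟶ᴼ_ M A w) c d → head (proj₁ c) ≤ suc (length w) → head (proj₁ d) ≤ suc (length w)
    stay-valid ε                         b = b
    stay-valid (move {a = a} _ _ ◅ s)    b = stay-valid s (moveInput-≤ w (Action.inputDir a) b)
    stay-valid (ask-yes _ ◅ s)           b = stay-valid s b
    stay-valid (ask-no _ ◅ s)            b = stay-valid s b

  Next : ConfigM → ConfigM → Set
  Next c d = ∃[ a ] ∃[ o ] state c ≢ M.query ×
    M.δ (state c) (scan w (head c)) (Tape.current (work c)) ≡ just (a , o) × d ≡ perform M.blank w a c

  Ended : ConfigM → Set
  Ended c = state c ≡ M.query ⊎ M.δ (state c) (scan w (head c)) (Tape.current (work c)) ≡ nothing

  -- A relation on configurations without the oracle tape suffices, since that tape is empty right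
  -- after a query: `σ` determines the next query and `A` its answer.
  NextPeriod : ConfigM → ConfigM → Set
  NextPeriod σ τ = ∃[ c ] ∃[ y ] ∃[ b ] run fuel σ ≡ query c y × Answered b y × τ ≡ resume b c

  Accepted : ConfigM → Set
  Accepted σ = run fuel σ ≡ accept

  next-deterministic : ∀ {x y z} → Next x y → Next x z → y ≡ z
  next-deterministic (a , o , _ , e , refl) (a′ , o′ , _ , e′ , refl) with refl ← trans (sym e) e′ = refl

  next-end : ∀ {x y} → Ended x → ¬ Next x y
  next-end (inj₁ q) (_ , _ , ¬q , _)     = ¬q q
  next-end (inj₂ e) (_ , _ , _ , e′ , _) with () ← trans (sym e) e′

  answered-same : ∀ b b′ {y} → Answered b y → Answered b′ y → b ≡ b′
  answered-same true  true  _ _ = refl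
  answered-same false false _ _ = refl
  answered-same true  false a ¬a = contradiction a ¬a
  answered-same false true  ¬a a = contradiction a ¬a

  period-deterministic : ∀ {x y z} → NextPeriod x y → NextPeriod x z → y ≡ z
  period-deterministic (c , y , b , e , a , refl) (c′ , y′ , b′ , e′ , a′ , refl)
    with refl ← trans (sym e) e′ with refl ← answered-same b b′ a a′ = refl

  period-end : ∀ {x y} → Accepted x → ¬ NextPeriod x y
  period-end e (_ , _ , _ , e′ , _) with () ← trans (sym e) e′

  module Steps   = Pigeonhole Next Ended Good next-deterministic next-end code code-injective
  module Periods = Pigeonhole NextPeriod Accepted Good period-deterministic period-end code code-injective

  -- Here `y` already stands on the oracle tape, while a result records only the word `z` written
  -- later; the query asked is `y ++ z`.
  Leads : Result → List Σ → Set
  Leads dead        y = ⊥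
  Leads accept      y = ⊤
  Leads (query c z) y = ∃[ b ] Answered b (y ++ z) × ∃ (Periods.Dist (resume b c))

  leads-output : ∀ o r {y} → Leads r (y ++ fromMaybe o) → Leads (output o r) y
  leads-output o accept      l = tt
  leads-output o (query c z) {y} (b , a , d) = b , subst (Answered b) (List.++-assoc y (fromMaybe o) z) a , d

  run-query : ∀ k c → state c ≡ M.query → run k c ≡ query c []
  run-query k c e with decEq M.finiteQ (state c) M.query
  ... | yes _ = refl
  ... | no ¬e = contradiction e ¬e

  run-accept : ∀ k c → T (M.accept (state c)) → run k c ≡ accept
  run-accept k c t with decEq M.finiteQ (state c) M.query
  ... | yes e = contradiction (subst (T ∘ M.accept) e t) M.accept-query
  ... | no _ rewrite M.accept-δ {s = scan w (head c)} {g = Tape.current (work c)} t with M.accept (state c)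
  ...   | true = refl

  run-step : ∀ k c {a o} → state c ≢ M.query → M.δ (state c) (scan w (head c)) (Tape.current (work c)) ≡ just (a , o) →
    Fits L (work (perform M.blank w a c)) → run (suc k) c ≡ output o (run k (perform M.blank w a c))
  run-step k c {a} ¬q e f with decEq M.finiteQ (state c) M.query
  ... | yes q = contradiction q ¬q
  ... | no _ rewrite e with fits? L (work (perform M.blank w a c))
  ...   | yes _ = refl
  ...   | no ¬f = contradiction f ¬f

  -- The result is the same for every `k` from `n` on, so an accepting run can be followed back from
  -- its end before it is known that `fuel` suffices; `dist-bound` supplies that afterwards.
  Future : ConfigM → List Σ → Set
  Future c y = ∃[ n ] Steps.Dist c n × ∃[ r ] (∀ k → n ≤ k → run k c ≡ r) × Leads r y

  period-dist : ∀ {σ} → Reached σ [] → Future σ [] → ∃ (Periods.Dist σ)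
  period-dist r (n , d , accept , e , _) = 0 , Periods.stop (reached-good r) (e fuel (ℕ.≤-pred (ℕ.≤-trans (Steps.dist-bound d) enough)))
  period-dist r (n , d , query c z , e , b , a , m , pd) =
    suc m , Periods.next (reached-good r) (c , z , b , e fuel (ℕ.≤-pred (ℕ.≤-trans (Steps.dist-bound d) enough)) , a , refl) pd

  future : ∀ {c y d} → Reached c y → Star (_⟶ᴼ_ M A w) (c , y) d → T (M.accept (state (proj₁ d))) → Future c y
  future {c} r ε t = 0 , Steps.stop (reached-good r) (inj₂ (M.accept-δ t)) , accept , (λ k _ → run-accept k c t) , tt
  future {c} {y} r (move {a = a} {o} ¬q e ◅ s) t =
    let r′ = r ◅◅ (move ¬q e ◅ ε)
        n , d , res , eq , l = future r′ s t
    in suc n , Steps.next (reached-good r) (a , o , ¬q , e , refl) d , output o res ,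
       (λ { (suc k) (s≤s le) → trans (run-step k c ¬q e (fitting r′)) (cong (output o) (eq k le)) }) , leads-output o res l
  future {c} {y} r (ask-yes a ◅ s) t =
    let r′ = r ◅◅ (ask-yes a ◅ ε)
    in 0 , Steps.stop (reached-good r) (inj₁ refl) , query c [] , (λ k _ → run-query k c refl) ,
       true , subst (_∈ᴸ A) (sym (List.++-identityʳ y)) a , period-dist r′ (future r′ s t)
  future {c} {y} r (ask-no a ◅ s) t =
    let r′ = r ◅◅ (ask-no a ◅ ε)
    in 0 , Steps.stop (reached-good r) (inj₁ refl) , query c [] , (λ k _ → run-query k c refl) ,
       false , subst (_∉ᴸ A) (sym (List.++-identityʳ y)) a , period-dist r′ (future r′ s t)

  ∤-* : ∀ m n → p ∤ m → p ∤ n → p ∤ m * n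
  ∤-* m n ¬m ¬n d = [ ¬m , ¬n ]′ (euclidsLemma m n pr d)

  yes-period : ∀ k {c y} → p ∤ countN y → (p ∤ period (suc k) (query c y)) ⇔ (p ∤ total k (resume true c))
  yes-period k {c} {y} ¬d = mk⇔
    (λ ¬t d → ¬t (∣m∣n⇒∣m+n (∣n⇒∣m*n (countN y) d) rest))
    (λ ¬t d → ∤-* (countN y) (total k (resume true c)) ¬d ¬t
      (∣m+n∣m⇒∣n (subst (p ∣_) (ℕ.+-comm (countN y * total k (resume true c)) _) d) rest))
    where
    rest : p ∣ weight (countN y) (suc p₀) * total k (resume false c) + 0
    rest = subst (p ∣_) (sym (ℕ.+-identityʳ _)) (∣m⇒∣m*n (total k (resume false c)) (weight-zero p₀ (countN y) ¬d))

  no-period : ∀ k {c y} → p ∣ countN y → (p ∤ period (suc k) (query c y)) ⇔ (p ∤ total k (resume false c))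
  no-period k {c} {y} pd = mk⇔
    (λ ¬t d → ¬t (∣m∣n⇒∣m+n rest (subst (p ∣_) (sym (ℕ.+-identityʳ _)) (∣n⇒∣m*n (weight (countN y) (suc p₀)) d))))
    (λ ¬t d → ∤-* (weight (countN y) (suc p₀)) (total k (resume false c)) (weight-nonzero pr pd p₀ ℕ.≤-refl) ¬t
      (subst (p ∣_) (ℕ.+-identityʳ _) (∣m+n∣m⇒∣n d rest)))
    where
    rest : p ∣ countN y * total k (resume true c)
    rest = ∣m⇒∣m*n (total k (resume true c)) pd

  p∤1 : p ∤ 1
  p∤1 = >⇒∤ (s≤s (s≤s z≤n))

  -- Along the true answers each weight is prime to `p` and the wrong guess adds a multiple of `p`,
  -- so being nonzero modulo `p` travels from the accepting end back to `σ`.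
  complete : ∀ k {σ m} → Reached σ [] → Periods.Dist σ m → m ≤ k → p ∤ total k σ
  complete k r (Periods.stop _ e) le = subst (λ r → p ∤ period k r) (sym e) p∤1
  complete (suc k) {σ} r (Periods.next _ (c , y , b , e , a , refl) d) (s≤s le) =
    subst (λ r → p ∤ period (suc k) r) (sym e) (answered b a (complete k (asked b q a r′) d le))
    where
    s,q = subst (Halted σ) e (run-sound fuel σ)
    q = proj₂ s,q
    r′ = ⟿-reached (proj₁ s,q) r
    answered : ∀ b → Answered b y → p ∤ total k (resume b c) → p ∤ period (suc k) (query c y)
    answered true  a = Equivalence.from (yes-period k {c} {y} (Equivalence.to (oracle r′ q) a))
    answered false a = Equivalence.from (no-period k {c} {y} (decidable-stable (p ∣? countN y) (a ∘ Equivalence.from (oracle r′ q))))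

  -- `A` is a mere predicate, so the right answer is found by deciding whether `p` divides
  -- `countN y`. The total after that answer is again nonzero modulo `p`, and the accepting run is
  -- rebuilt query by query.
  sound : ∀ k {σ} → Reached σ [] → p ∤ total k σ → Accepts M A w
  sound k {σ} r = halt k (run fuel σ) (run-sound fuel σ)
    where
    halt : ∀ k res → Halted σ res → p ∤ period k res → Accepts M A w
    halt k dead   h ¬d = contradiction (divides 0 refl) ¬d
    halt k accept (y , c , s , t) ¬d = (c , y) , ⟿-reached s r , t
    halt zero    (query c y) h ¬d = contradiction (divides 0 refl) ¬d
    halt (suc k) (query c y) (s , q) ¬d = decided (p ∣? countN y)
      where
      decided : Dec (p ∣ countN y) → Accepts M A w
      decided (yes d) = sound k (asked false q (λ a → Equivalence.to (oracle (⟿-reached s r) q) a d) (⟿-reached s r)) (Equivalence.to (no-period k {c} {y} d) ¬d)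
      decided (no ¬p) = sound k (asked true q (Equivalence.from (oracle (⟿-reached s r) q) ¬p) (⟿-reached s r)) (Equivalence.to (yes-period k {c} {y} ¬p) ¬d)

  total-correct : Accepts M A w ⇔ p ∤ total fuel σ₀
  total-correct = mk⇔
    (λ (d , s , t) → let m , pd = period-dist ε (future ε s t) in
      complete fuel ε pd (ℕ.≤-pred (ℕ.≤-trans (Periods.dist-bound pd) enough)))
    (sound fuel ε)

-- Sizes

private
  value : List Bool → ℕ
  value []       = 0
  value (b ∷ bs) = (if b then 1 else 0) + 2 * value bs

  value-binarySucc : ∀ bs → value (binarySucc bs) ≡ suc (value bs)
  value-binarySucc []           = refl
  value-binarySucc (false ∷ bs) = refl
  value-binarySucc (true ∷ bs)  = trans (cong (2 *_) (value-binarySucc bs)) (ℕ.*-suc 2 (value bs))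

  value-binary : ∀ m → value (binary m) ≡ m
  value-binary zero    = refl
  value-binary (suc m) = trans (value-binarySucc (binary m)) (cong suc (value-binary m))

  value< : ∀ bs → value bs < 2 ^ length bs
  value< []       = s≤s z≤n
  value< (b ∷ bs) = ℕ.≤-trans (s≤s (ℕ.+-monoˡ-≤ (2 * value bs) (bit b)))
    (ℕ.≤-trans (ℕ.≤-reflexive (sym (ℕ.*-suc 2 (value bs)))) (ℕ.*-monoʳ-≤ 2 (value< bs)))
    where
    bit : ∀ b → (if b then 1 else 0) ≤ 1
    bit true  = ℕ.≤-refl
    bit false = z≤n

  -- Numerals whose most significant digit, which is stored last, is 1; this bounds the value from
  -- below in terms of the length.
  data Leading : List Bool → Set where
    one  : Leading (true ∷ [])
    more : ∀ b {bs} → Leading bs → Leading (b ∷ bs)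

  leading-binarySucc : ∀ {bs} → Leading bs → Leading (binarySucc bs)
  leading-binarySucc one            = more false one
  leading-binarySucc (more false l) = more true l
  leading-binarySucc (more true l)  = more false (leading-binarySucc l)

  leading-binary : ∀ m → Leading (binary (suc m))
  leading-binary zero    = one
  leading-binary (suc m) = leading-binarySucc (leading-binary m)

  leading-value : ∀ {bs} → Leading bs → 2 ^ length bs ≤ 2 * value bs
  leading-value one               = ℕ.≤-refl
  leading-value (more b {bs} l) = ℕ.*-monoʳ-≤ 2 (ℕ.≤-trans (leading-value l) (ℕ.m≤n+m (2 * value bs) (if b then 1 else 0)))

binary-upper : ∀ m → m < 2 ^ length (binary m)
binary-upper m = subst (_< 2 ^ length (binary m)) (value-binary m) (value< (binary m))

binary-lower : ∀ m → 2 ^ length (binary (suc m)) ≤ 2 * suc m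
binary-lower m = subst (λ n → 2 ^ length (binary (suc m)) ≤ 2 * n) (value-binary (suc m)) (leading-value (leading-binary m))

n<2^1+⌊log₂n⌋ : ∀ n → n < 2 ^ suc ⌊log₂ n ⌋
n<2^1+⌊log₂n⌋ n = ℕ.≰⇒> λ le → ℕ.1+n≰n (subst (_≤ ⌊log₂ n ⌋) (⌊log₂[2^n]⌋≡n (suc ⌊log₂ n ⌋)) (⌊log₂⌋-mono-≤ le))

⌊log₂⌋≤ : ∀ {n k} → n ≤ 2 ^ k → ⌊log₂ n ⌋ ≤ k
⌊log₂⌋≤ {n} {k} le = subst (⌊log₂ n ⌋ ≤_) (⌊log₂[2^n]⌋≡n k) (⌊log₂⌋-mono-≤ le)

2^-cancel-≤ : ∀ {j k} → 2 ^ j ≤ 2 ^ k → j ≤ k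
2^-cancel-≤ {j} {k} le = subst (_≤ k) (⌊log₂[2^n]⌋≡n j) (⌊log₂⌋≤ le)

1≤2^ : ∀ k → 1 ≤ 2 ^ k
1≤2^ k = ℕ.m^n>0 2 k

k<2^k : ∀ k → k < 2 ^ k
k<2^k zero    = s≤s z≤n
k<2^k (suc k) = ℕ.≤-trans (ℕ.+-mono-≤ (1≤2^ k) (k<2^k k)) (ℕ.≤-reflexive (cong (2 ^ k +_) (sym (ℕ.+-identityʳ (2 ^ k)))))

module BinaryLength (n : ℕ) where
  ℓ : ℕ
  ℓ = length (binary (2 + n))

  wide-2 : 3 + n ≤ 2 ^ ℓ
  wide-2 = binary-upper (2 + n)

  1≤ℓ : 1 ≤ ℓ
  1≤ℓ = go ℓ wide-2
    where
    go : ∀ k → 3 + n ≤ 2 ^ k → 1 ≤ k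
    go zero    (s≤s ())
    go (suc k) _ = s≤s z≤n

  log≤ : suc ⌊log₂ n ⌋ ≤ 2 * ℓ
  log≤ = ℕ.≤-trans (ℕ.+-mono-≤ 1≤ℓ (⌊log₂⌋≤ (ℕ.≤-trans (ℕ.m≤n+m n 3) wide-2))) (ℕ.≤-reflexive (cong (ℓ +_) (sym (ℕ.+-identityʳ ℓ))))

  ≤log : ℓ ≤ 3 * suc ⌊log₂ n ⌋
  ≤log = ℕ.≤-trans (2^-cancel-≤ {k = 3 + l} bound) (ℕ.≤-trans (ℕ.+-monoʳ-≤ 3 (ℕ.m≤n*m l 3)) (ℕ.≤-reflexive (sym (ℕ.*-suc 3 l))))
    where
    l = ⌊log₂ n ⌋
    bound : 2 ^ ℓ ≤ 2 ^ (3 + l)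
    bound = begin
      2 ^ ℓ                        ≤⟨ binary-lower (suc n) ⟩
      2 * (2 + n)                  ≤⟨ ℕ.*-monoʳ-≤ 2 (ℕ.+-mono-≤ (1≤2^ (suc l)) (n<2^1+⌊log₂n⌋ n)) ⟩
      2 * (2 ^ suc l + 2 ^ suc l)  ≡⟨ cong (λ x → 2 * (2 ^ suc l + x)) (sym (ℕ.+-identityʳ (2 ^ suc l))) ⟩
      2 ^ (3 + l)                  ∎
      where open ℕ.≤-Reasoning

  -- Both n^k and k are at most 2^(ℓk), and the factor 4 left over is at most 2^(2ℓ). The 2 on the
  -- left accounts for the endmarkers of a query of length `m`.
  polynomial : ∀ k {m} → m ≤ n ^ k + k → 2 + m ≤ 2 ^ (ℓ * (2 + k))
  polynomial k {m} le = begin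
    2 + m                            ≤⟨ ℕ.+-monoʳ-≤ 2 le ⟩
    2 + (n ^ k + k)                  ≤⟨ ℕ.+-mono-≤ 2≤2Z (ℕ.+-mono-≤ n^k≤Z k≤Z) ⟩
    (Z + Z) + (Z + Z)                ≡⟨ four Z ⟩
    4 * Z                            ≤⟨ ℕ.*-monoˡ-≤ Z (ℕ.^-monoʳ-≤ 2 (ℕ.*-monoˡ-≤ 2 1≤ℓ)) ⟩
    2 ^ (ℓ * 2) * Z                  ≡⟨ sym (ℕ.^-distribˡ-+-* 2 (ℓ * 2) (ℓ * k)) ⟩
    2 ^ (ℓ * 2 + ℓ * k)              ≡⟨ cong (2 ^_) (sym (ℕ.*-distribˡ-+ ℓ 2 k)) ⟩
    2 ^ (ℓ * (2 + k))                ∎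
    where
    open ℕ.≤-Reasoning
    Z = 2 ^ (ℓ * k)
    2≤2Z : 2 ≤ Z + Z
    2≤2Z = ℕ.+-mono-≤ (1≤2^ (ℓ * k)) (1≤2^ (ℓ * k))
    n^k≤Z : n ^ k ≤ Z
    n^k≤Z = ℕ.≤-trans (ℕ.^-monoˡ-≤ k (ℕ.≤-trans (ℕ.m≤n+m n 3) wide-2)) (ℕ.≤-reflexive (ℕ.^-*-assoc 2 ℓ k))
    k≤Z : k ≤ Z
    k≤Z = ℕ.≤-trans (ℕ.<⇒≤ (k<2^k k)) (ℕ.^-monoʳ-≤ 2 (ℕ.≤-trans (ℕ.≤-reflexive (sym (ℕ.*-identityˡ k))) (ℕ.*-monoˡ-≤ k 1≤ℓ)))
    four : ∀ z → (z + z) + (z + z) ≡ 4 * z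
    four = solve-∀

module _ {G : Set} (finite : Finite G) (blank : G) (β : ℕ) (small : proj₁ finite ≤ 2 + β) where
  private
    open Tracks (suc β) 12
    n = proj₁ finite
    e = proj₂ finite

    decode : (a : Fin (2 + β)) → Dec (toℕ a < n) → G
    decode a (yes lt) = Inverse.from e (fromℕ< lt)
    decode a (no _)   = blank

    decode-encode : ∀ g d → decode (Fin.inject≤ (Inverse.to e g) small) d ≡ g
    decode-encode g (yes lt) = trans (cong (Inverse.from e)
      (Fin.toℕ-injective (trans (Fin.toℕ-fromℕ< lt) (Fin.toℕ-inject≤ (Inverse.to e g) small)))) (Inverse.strictlyInverseʳ e g)
    decode-encode g (no ¬lt) = contradiction (subst (_< n) (sym (Fin.toℕ-inject≤ (Inverse.to e g) small)) (Fin.toℕ<n (Inverse.to e g))) ¬lt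

    dec′ : A → G
    dec′ zero    = blank
    dec′ (suc a) = decode a (toℕ a ℕ.<? n)

  coding : Coding blank
  coding = record
    { enc     = λ g → Fin.inject≤ (Inverse.to e g) small
    ; dec     = dec′
    ; dec-0   = refl
    ; dec-enc = λ g → decode-encode g (toℕ (Fin.inject≤ (Inverse.to e g) small) ℕ.<? n)
    }

finite-Vec-size : {Y : Set} (f : Finite Y) (n : ℕ) → proj₁ (finite-Vec f n) ≡ proj₁ f ^ n
finite-Vec-size f zero    = refl
finite-Vec-size f (suc n) = cong (proj₁ f *_) (finite-Vec-size f n)

m≤m^n : ∀ m {n} → 1 ≤ n → m ≤ m ^ n
m≤m^n zero    (s≤s _) = z≤n
m≤m^n (suc m) {suc n} (s≤s _) = ℕ.m≤m*n (suc m) (suc m ^ n) {{ℕ.m^n≢0 (suc m) n}}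

*-^-distrib : ∀ o m n → (m * n) ^ o ≡ m ^ o * n ^ o
*-^-distrib zero    m n = refl
*-^-distrib (suc o) m n = trans (cong (m * n *_) (*-^-distrib o m n)) (ℕ.[m*n]*[o*p]≡[m*o]*[n*p] m n (m ^ o) (n ^ o))

-- Each factor of the number of codes is at most an `L`-th power of a constant, so their product is
-- too; a clock with `L` digits in a base above that constant covers it.
configurations-bound : {Σ : Set} (M : OracleTM Σ) (A : Language Σ) (w : List Σ) {L b : ℕ} →
  let q = proj₁ (OracleTM.finiteQ M) ; g = proj₁ (OracleTM.finiteΓ M) in
  1 ≤ L → 2 + length w ≤ 2 ^ L → q * (2 * (g * (suc g * suc g))) ≤ b → OracleMath.configurations M A w L ≤ b ^ L
configurations-bound M A w {L} {b} 1≤L wide le = begin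
  q * ((2 + length w) * (g * (vec * vec)))                 ≡⟨ cong (λ x → q * ((2 + length w) * (g * (x * x)))) (finite-Vec-size (finite-Maybe (OracleTM.finiteΓ M)) L) ⟩
  q * ((2 + length w) * (g * (h ^ L * h ^ L)))             ≤⟨ ℕ.*-mono-≤ (m≤m^n q 1≤L) (ℕ.*-mono-≤ wide (ℕ.*-monoˡ-≤ (h ^ L * h ^ L) (m≤m^n g 1≤L))) ⟩
  q ^ L * (2 ^ L * (g ^ L * (h ^ L * h ^ L)))              ≡⟨ cong (λ x → q ^ L * (2 ^ L * (g ^ L * x))) (sym (*-^-distrib L h h)) ⟩
  q ^ L * (2 ^ L * (g ^ L * (h * h) ^ L))                  ≡⟨ cong (λ x → q ^ L * (2 ^ L * x)) (sym (*-^-distrib L g (h * h))) ⟩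
  q ^ L * (2 ^ L * (g * (h * h)) ^ L)                      ≡⟨ cong (q ^ L *_) (sym (*-^-distrib L 2 (g * (h * h)))) ⟩
  q ^ L * (2 * (g * (h * h))) ^ L                          ≡⟨ sym (*-^-distrib L q (2 * (g * (h * h)))) ⟩
  (q * (2 * (g * (h * h)))) ^ L                            ≤⟨ ℕ.^-monoˡ-≤ L le ⟩
  b ^ L                                                    ∎
  where
  open ℕ.≤-Reasoning
  q = proj₁ (OracleTM.finiteQ M)
  g = proj₁ (OracleTM.finiteΓ M)
  h = suc g
  vec = proj₁ (finite-Vec (finite-Maybe (OracleTM.finiteΓ M)) L)

initial-head : {Σ : Set} (N : NTM Σ) (y : List Σ) {c d : Config (NTM.Q N) (NTM.Γ N)} →
  Star (_⟶_ N y) c d → head c ≤ suc (length y) → head d ≤ suc (length y)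
initial-head N y ε                b = b
initial-head N y (move {a} _ ◅ s) b = initial-head N y s (moveInput-≤ y (Action.inputDir a) b)

fits-space : {Γ : Set} {L : ℕ} (t : Tape Γ) → visited t ≤ L → Fits L t
fits-space (tape l g r) le =
  ℕ.≤-trans (ℕ.m≤m+n (length l) (length r)) (ℕ.≤-trans (ℕ.n≤1+n _) le) ,
  ℕ.≤-trans (ℕ.m≤n+m (length r) (length l)) (ℕ.≤-trans (ℕ.n≤1+n _) le)

-- Choice of the constants and the resulting counting machine

module Forward {Σ : Set} (finiteΣ : Finite Σ) (p₀ : ℕ) (pr : Prime (2 + p₀))
  (A : Language Σ) (f : List Σ → ℕ) (N : NTM Σ)
  (CN : ℕ) (spaceN : ∀ y {d} → Star (_⟶_ N y) (initial (NTM.start N) (NTM.blank N)) d → LogBound CN (length y) (space d))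
  (halts : ∀ y → Halts N y) (countf : ∀ y → Fin (f y) ↔ AcceptingPaths N y)
  (A⇔f : ∀ y → y ∈ᴸ A ⇔ (2 + p₀) ∤ f y)
  (M : OracleTM Σ)
  (CM : ℕ) (spaceM : ∀ w {c} → Reachable M A w c → LogBound CM (length w) (space (proj₁ c)))
  (k : ℕ) (poly : ∀ w {c y} → Reachable M A w (c , y) → state c ≡ OracleTM.query M → length y ≤ length w ^ k + k) where

  private
    q g h : ℕ
    q = proj₁ (OracleTM.finiteQ M)
    g = proj₁ (OracleTM.finiteΓ M)
    h = proj₁ (NTM.finiteΓ N)

  -- With ℓ the binary length of `2 + length w`, there are ℓ(D + 1) cells, and `D` adds up three
  -- needs in units of ℓ: the tape of `M`, as 1 + log n is at most 2ℓ; the tape of `N` on a query of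
  -- length at most n^k + k, where 1 + log is at most ℓ(3 + k); and the positions on such a query,
  -- which are below 2^(ℓ(2 + k)). The `L`-th power of `digits` bounds the configurations of `M`,
  -- and `g + h` makes room for the codes of both tape alphabets.
  D digits β : ℕ
  D = CM * 2 + (CN * (3 + k) + (2 + k))
  digits = q * (2 * (g * (suc g * suc g)))
  β = digits + (g + h)

  codingM : Tracks.Coding (suc β) 12 (OracleTM.blank M)
  codingM = coding (OracleTM.finiteΓ M) (OracleTM.blank M) β
    (ℕ.≤-trans (ℕ.m≤m+n g h) (ℕ.≤-trans (ℕ.m≤n+m (g + h) digits) (ℕ.m≤n+m β 2)))

  codingN : Tracks.Coding (suc β) 12 (NTM.blank N)
  codingN = coding (NTM.finiteΓ N) (NTM.blank N) β
    (ℕ.≤-trans (ℕ.m≤n+m h g) (ℕ.≤-trans (ℕ.m≤n+m (g + h) digits) (ℕ.m≤n+m β 2)))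

  open InitCorrect finiteΣ M N p₀ D β codingM codingN using (size; length-blocks; machine-correct)
  open Program finiteΣ M N p₀ D β codingM codingN using (machine)

  module _ (w : List Σ) where
    open BinaryLength (length w)

    L : ℕ
    L = size (2 + length w)

    L≡ : L ≡ ℓ * suc D
    L≡ = length-blocks (binary (2 + length w))

    multiple : ∀ {c} → c ≤ suc D → ℓ * c ≤ L
    multiple le = ℕ.≤-trans (ℕ.*-monoʳ-≤ ℓ le) (ℕ.≤-reflexive (sym L≡))

    ℓ≤L : ℓ ≤ L
    ℓ≤L = ℕ.≤-trans (ℕ.≤-reflexive (sym (ℕ.*-identityʳ ℓ))) (multiple (s≤s z≤n))

    2^L≤ : 2 ^ L ≤ (3 + β) ^ L
    2^L≤ = ℕ.^-monoˡ-≤ L (s≤s (s≤s z≤n))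

    wide-2^L : 2 + length w ≤ 2 ^ L
    wide-2^L = ℕ.≤-trans (ℕ.n≤1+n _) (ℕ.≤-trans wide-2 (ℕ.^-monoʳ-≤ 2 ℓ≤L))

    wide : 2 + length w ≤ (3 + β) ^ L
    wide = ℕ.≤-trans wide-2^L 2^L≤

    fuel : ℕ
    fuel = Tracks.val (suc β) 12 (replicate L (Tracks.top (suc β) 12))

    enough : OracleMath.configurations M A w L ≤ suc fuel
    enough = ℕ.≤-trans (configurations-bound M A w (ℕ.≤-trans 1≤ℓ ℓ≤L) wide-2^L (ℕ.≤-trans (ℕ.m≤m+n digits (g + h)) (ℕ.m≤n+m β 3)))
      (ℕ.≤-reflexive (sym (Tracks.val-top (suc β) 12 L)))

    fitting : ∀ {c y} → Reachable M A w (c , y) → Fits L (work c)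
    fitting {c} r = fits-space (work c) (begin
      visited (work c)                ≤⟨ spaceM w r ⟩
      CM * suc ⌊log₂ length w ⌋       ≤⟨ ℕ.*-monoʳ-≤ CM log≤ ⟩
      CM * (2 * ℓ)                    ≡⟨ sym (ℕ.*-assoc CM 2 ℓ) ⟩
      CM * 2 * ℓ                      ≡⟨ ℕ.*-comm (CM * 2) ℓ ⟩
      ℓ * (CM * 2)                    ≤⟨ multiple (ℕ.≤-trans (ℕ.m≤m+n _ _) (ℕ.n≤1+n D)) ⟩
      L                               ∎)
      where open ℕ.≤-Reasoning

    countN : List Σ → ℕ
    countN y = proj₁ (Simulated.tree N y L ((3 + β) ^ L) (halts y))

    -- On short words all of the computation of `N` fits, so nothing is pruned; two bijections with
    -- the same set of accepting paths then give equal numbers.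
    countN≡f : ∀ y → length y ≤ length w ^ k + k → countN y ≡ f y
    countN≡f y short = ↔⇒≡ (↔-trans (Counting.paths N y (λ _ → ⊤) (Simulated.tree-comp N y L _ allowed
        (proj₂ (Simulated.tree N y L ((3 + β) ^ L) (halts y))))) (↔-sym (countf y)))
      where
      open ℕ.≤-Reasoning
      short′ : 2 + length y ≤ 2 ^ (ℓ * (2 + k))
      short′ = polynomial k short
      log-y : suc ⌊log₂ length y ⌋ ≤ ℓ * (3 + k)
      log-y = begin
        suc ⌊log₂ length y ⌋        ≤⟨ ℕ.+-mono-≤ 1≤ℓ (⌊log₂⌋≤ {k = ℓ * (2 + k)} (ℕ.≤-trans (ℕ.m≤n+m (length y) 2) short′)) ⟩
        ℓ + ℓ * (2 + k)             ≡⟨ sym (ℕ.*-suc ℓ (2 + k)) ⟩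
        ℓ * (3 + k)                 ∎
      swap : ∀ a b c → a * (b * c) ≡ b * (a * c)
      swap = solve-∀
      allowed : ∀ {d} → Star (_⟶_ N y) (initial (NTM.start N) (NTM.blank N)) d → Fits L (work d) × head d < (3 + β) ^ L
      allowed {d} s = fits-space (work d) (begin
          visited (work d)              ≤⟨ spaceN y s ⟩
          CN * suc ⌊log₂ length y ⌋     ≤⟨ ℕ.*-monoʳ-≤ CN log-y ⟩
          CN * (ℓ * (3 + k))            ≡⟨ swap CN ℓ (3 + k) ⟩
          ℓ * (CN * (3 + k))            ≤⟨ multiple (ℕ.≤-trans (ℕ.m≤m+n _ (2 + k)) (ℕ.≤-trans (ℕ.m≤n+m _ (CM * 2)) (ℕ.n≤1+n D))) ⟩
          L                             ∎) ,
        (begin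
          suc (head d)                  ≤⟨ s≤s (initial-head N y s z≤n) ⟩
          2 + length y                  ≤⟨ short′ ⟩
          2 ^ (ℓ * (2 + k))             ≤⟨ ℕ.^-monoʳ-≤ 2 (multiple (ℕ.≤-trans (ℕ.m≤n+m (2 + k) (CN * (3 + k))) (ℕ.≤-trans (ℕ.m≤n+m _ (CM * 2)) (ℕ.n≤1+n D)))) ⟩
          2 ^ L                         ≤⟨ 2^L≤ ⟩
          (3 + β) ^ L                   ∎)

    oracle : ∀ {c y} → Reachable M A w (c , y) → state c ≡ OracleTM.query M → y ∈ᴸ A ⇔ (2 + p₀) ∤ countN y
    oracle {y = y} r q = subst (λ n → y ∈ᴸ A ⇔ (2 + p₀) ∤ n) (sym (countN≡f y (poly w r q))) (A⇔f y)

    open OracleTotals M A w L fuel countN p₀ pr oracle fitting enough using (σ₀; total-correct)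
    open Totals M w L fuel countN p₀ using (total)

    paths : ℕ
    paths = total fuel σ₀

    correct : Accepts M A w ⇔ (2 + p₀) ∤ paths
    correct = total-correct

    computation : Counting.Comp machine w (λ c → space c ≤ 3 + L) (initial (NTM.start machine) (NTM.blank machine)) paths
    computation = machine-correct halts w wide

    room-bound : 3 + L ≤ (3 + 3 * suc D) * suc ⌊log₂ length w ⌋
    room-bound = begin
      3 + L                               ≡⟨ cong (3 +_) L≡ ⟩
      3 + ℓ * suc D                       ≤⟨ ℕ.+-mono-≤ (ℕ.m≤m*n 3 λ′) (ℕ.*-monoˡ-≤ (suc D) ≤log) ⟩
      3 * λ′ + 3 * λ′ * suc D             ≡⟨ rearrange λ′ (suc D) ⟩
      (3 + 3 * suc D) * λ′                ∎
      where
      open ℕ.≤-Reasoning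
      λ′ = suc ⌊log₂ length w ⌋
      rearrange : ∀ a b → 3 * a + 3 * a * b ≡ (3 + 3 * b) * a
      rearrange = solve-∀

  paths∈♯L : paths ∈ᴸ ♯L
  paths∈♯L = machine
    , ((3 + 3 * suc D , λ w s → ℕ.≤-trans (Counting.reachable-P machine w _ (computation w) s) (room-bound w))
      , λ w → Counting.halting machine w _ (computation w))
    , λ w → Counting.paths machine w _ (computation w)

oracle-reduction : {Σ : Set} → Finite Σ → ∀ {p₀} → Prime (2 + p₀) → ∀ {Lg : Language Σ} →
  Lg ∈ᴸ (L^ (Mod_L {Σ} (2 + p₀))) → Lg ∈ᴸ Mod_L {Σ} (2 + p₀)
oracle-reduction finiteΣ {p₀} pr (A , (f , (N , ((CN , spaceN) , halts) , countf) , A⇔f) , M , (CM , spaceM) , (k , poly) , L⇔M) =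
  F.paths , F.paths∈♯L , λ w → mk⇔
    (λ w∈L → Equivalence.to (F.correct w) (Equivalence.to (L⇔M w) w∈L))
    (λ ¬d → Equivalence.from (L⇔M w) (Equivalence.from (F.correct w) ¬d))
  where module F = Forward finiteΣ p₀ pr A f N CN spaceN halts countf A⇔f M CM spaceM k poly

-- Every class is contained in its log-space oracle closure

look-++ : {Σ : Set} (pre : List Σ) {a : Σ} {post : List Σ} → look (pre ++ a ∷ post) (length pre) ≡ char a
look-++ []        = refl
look-++ (_ ∷ pre) = look-++ pre

module Copying {Σ : Set} (finiteΣ : Finite Σ) where

  pattern copying = 0F
  pattern asking  = 1F
  pattern yes!    = 2F
  pattern no!     = 3F

  copy : Fin 4 → InputSymbol Σ → ⊤ → Maybe (Action (Fin 4) ⊤ × Maybe Σ)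
  copy copying ⊢        _ = just (action copying tt right stay , nothing)
  copy copying (char a) _ = just (action copying tt right stay , just a)
  copy copying ⊣        _ = just (action asking tt stay stay , nothing)
  copy _       _        _ = nothing

  said-yes : Fin 4 → Bool
  said-yes yes! = true
  said-yes _    = false

  copier : OracleTM Σ
  copier = record
    { Q = Fin 4 ; Γ = ⊤ ; finiteQ = finite-Fin 4 ; finiteΓ = finite-⊤
    ; start = copying ; query = asking ; yes = yes! ; no = no! ; blank = tt
    ; accept = said-yes ; δ = copy
    ; accept-δ = λ { {yes!} _ → refl }
    ; accept-query = id }

  module _ (A : Language Σ) (w : List Σ) where
    unused : Tape ⊤
    unused = tape [] tt []

    -- While copying, the head position `suc (length pre)` shows how much has been read, and exactly
    -- `pre` stands on the oracle tape; hence the query is the input itself.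
    data Inv : Config (Fin 4) ⊤ × List Σ → Set where
      beginning  : Inv (config copying 0 unused , [])
      copied     : ∀ pre {post} → pre ++ post ≡ w → Inv (config copying (suc (length pre)) unused , pre)
      asked      : ∀ {i} → Inv (config asking i unused , w)
      answer-yes : ∀ {i} → w ∈ᴸ A → Inv (config yes! i unused , [])
      answer-no  : ∀ {i} → Inv (config no! i unused , [])

    at-char : ∀ pre {a post} → pre ++ a ∷ post ≡ w → scan w (suc (length pre)) ≡ char a
    at-char pre refl = trans (scan-look w (length pre)) (look-++ pre)

    at-end : ∀ pre → pre ++ [] ≡ w → scan w (suc (length pre)) ≡ ⊣
    at-end pre refl = trans (scan-look w (length pre)) (look-≥ w (length pre) (ℕ.≤-reflexive (cong length (List.++-identityʳ pre))))

    after-char : ∀ pre {a post} → pre ++ a ∷ post ≡ w →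
      moveInput w right (suc (length pre)) ≡ suc (length (pre ++ a ∷ []))
    after-char pre {a} {post} refl = trans (moveInput-right w longer) (cong suc (sym (trans (List.length-++ pre) (ℕ.+-comm (length pre) 1))))
      where
      longer : suc (length pre) ≤ length (pre ++ a ∷ post)
      longer = ℕ.≤-trans (ℕ.m≤m+n _ (length post)) (ℕ.≤-reflexive (trans (sym (ℕ.+-suc (length pre) (length post))) (sym (List.length-++ pre))))

    step-inv : ∀ {c d} → Inv c → _⟶ᴼ_ copier A w c d → Inv d
    step-inv beginning (move _ refl) = copied [] refl
    step-inv (copied pre {[]} e) (move _ eq) with scan w (suc (length pre)) | at-end pre e
    step-inv (copied pre {[]} e) (move _ refl) | _ | refl = subst (λ y → Inv (config asking (suc (length pre)) unused , y))
      (trans (sym e) refl) asked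
    step-inv (copied pre {a ∷ post} e) (move _ eq) with scan w (suc (length pre)) | at-char pre e
    step-inv (copied pre {a ∷ post} e) (move _ refl) | _ | refl = subst (λ i → Inv (config copying i unused , pre ++ a ∷ []))
      (sym (after-char pre e)) (copied (pre ++ a ∷ []) (trans (List.++-assoc pre (a ∷ []) post) e))
    step-inv asked (move ¬q _)   = contradiction refl ¬q
    step-inv asked (ask-yes a)   = answer-yes a
    step-inv asked (ask-no ¬a)   = answer-no
    step-inv (answer-yes _) (move _ ())
    step-inv answer-no (move _ ())

    inv : ∀ {c d} → Inv c → Star (_⟶ᴼ_ copier A w) c d → Inv d
    inv i ε       = i
    inv i (s ◅ r) = inv (step-inv i s) r

    reachable-inv : ∀ {c} → Reachable copier A w c → Inv c
    reachable-inv = inv beginning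

    copies : ∀ pre post → pre ++ post ≡ w →
      ∃[ i ] Star (_⟶ᴼ_ copier A w) (config copying (suc (length pre)) unused , pre) (config asking i unused , w)
    copies pre [] e = _ , subst (λ y → Star (_⟶ᴼ_ copier A w) (config copying (suc (length pre)) unused , pre) (config asking (suc (length pre)) unused , y))
      e (move (λ ()) (cong (λ s → copy copying s tt) (at-end pre e)) ◅ ε)
    copies pre (a ∷ post) e =
      let i , r = copies (pre ++ a ∷ []) post (trans (List.++-assoc pre (a ∷ []) post) e)
      in i , move (λ ()) (cong (λ s → copy copying s tt) (at-char pre e))
           ◅ subst (λ j → Star (_⟶ᴼ_ copier A w) (config copying j unused , pre ++ a ∷ []) (config asking i unused , w)) (sym (after-char pre e)) r

    accepts⇔ : w ∈ᴸ A ⇔ Accepts copier A w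
    accepts⇔ = mk⇔
      (λ a → let i , r = copies [] w refl in _ , move (λ ()) refl ◅ (r ◅◅ (ask-yes a ◅ ε)) , tt)
      (λ (c , r , t) → said (reachable-inv r) t)
      where
      said : ∀ {c} → Inv c → T (said-yes (state (proj₁ c))) → w ∈ᴸ A
      said (answer-yes a) _ = a

    one-cell : ∀ {c} → Inv c → space (proj₁ c) ≡ 1
    one-cell beginning      = refl
    one-cell (copied _ _)   = refl
    one-cell asked          = refl
    one-cell (answer-yes _) = refl
    one-cell answer-no      = refl

    query-length : ∀ {c y} → Inv (c , y) → state c ≡ asking → length y ≤ length w ^ 1 + 1
    query-length asked _ = ℕ.≤-trans (ℕ.≤-reflexive (sym (ℕ.^-identityʳ (length w)))) (ℕ.m≤m+n _ 1)

self-reduction : {Σ : Set} → Finite Σ → {𝒞 : Pred (Language Σ) _} → ∀ {A : Language Σ} → A ∈ᴸ 𝒞 → A ∈ᴸ (L^ 𝒞)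
self-reduction finiteΣ {A = A} A∈𝒞 = A , A∈𝒞 , copier
  , (1 , λ w r → ℕ.≤-trans (ℕ.≤-reflexive (one-cell A w (reachable-inv A w r))) (s≤s z≤n))
  , (1 , λ w r → query-length A w (reachable-inv A w r))
  , accepts⇔ A
  where open Copying finiteΣ

theorem3p7 : (Σ : Set) → Finite Σ → (p : ℕ) → Prime p →
    L^ (Mod_L {Σ} p) ≐ Mod_L {Σ} p
theorem3p7 Σ finiteΣ zero           pr = contradiction pr ¬prime[0]
theorem3p7 Σ finiteΣ (suc zero)     pr = contradiction pr ¬prime[1]
theorem3p7 Σ finiteΣ (suc (suc p₀)) pr = oracle-reduction finiteΣ pr , self-reduction finiteΣ
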